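{- Let $\Phi$ be a finite root system (of any rank) with Weyl (Coxeter) group $W$, and let $\overline{\Phi}$ be its set of rays with involution $\ast$ given by negation. Then $\Phi$ has a unique oriented matroid root system structure; that is, there is exactly one closure operator $d$ on $\overline{\Phi}$ such that $(\overline{\Phi},\ast,d)$ is an oriented matroid root system for $W$.
   Context: **Root systems.** Let $V$ be a finite-dimensional real vector space with a symmetric bilinear form $(\cdot,\cdot)$, and let $\Pi\subset V$ be a finite set (the simple roots) which is positively independent (a linear combination of $\Pi$ with nonnegative coefficients is $0$ only if all coefficients are $0$), with $(\alpha,\alpha)>0$ for $\alpha\in\Pi$, and with $\frac{(\alpha,\beta)}{\sqrt{(\alpha,\alpha)(\beta,\beta)}}\in\{ -\cos(\pi/m): m\in\mathbb{Z}_{\ge2}\}\cup(-\infty,-1]$ for distinct $\alpha,\beta\in\Pi$. Let $s_\alpha(v)=v-2\frac{(v,\alpha)}{(\alpha,\alpha)}\alpha$, $S=\{s_\alpha:\alpha\in\Pi\}$, $W=\langle S\rangle$ (then $(W,S)$ is a Coxeter system), $\Phi=W\Pi$ (a root system with base $\Pi$), $\Phi^+=\Phi\cap\operatorname{cone}(\Pi)$, so $\Phi=\Phi^+\sqcup-\Phi^+$. The root system is finite if $\Phi$ is a finite set. Here $\operatorname{cone}(A)$ is the set of finite nonnegative real linear combinations of elements of $A$ (so $\operatorname{cone}(\varnothing)=\{0\}$). **Reduction.** $\overline{\Phi}$ is the quotient of $\Phi$ identifying roots that are positive scalar multiples of each other (i.e. the set of rays spanned by roots); $\overline{\alpha}$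 is the class of $\alpha$, $\overline{\Phi}^+$ is the image of $\Phi^+$, the involution $\ast$ on $\overline{\Phi}$ is $\overline{\alpha}\mapsto\overline{ -\alpha}$, and $W$ acts on $\overline{\Phi}$. For $X\subseteq\overline{\Phi}$, $\operatorname{cone}_\Phi(X)$ is the set of elements of $\overline{\Phi}$ whose representatives lie in the cone generated by representatives of $X$. **Oriented matroids.** An oriented matroid is a triple $(E,\ast,\mathrm{cx})$ where $E$ is a (possibly infinite) set, $\ast:E\to E$ is a fixed-point-free involution, and $\mathrm{cx}$ is a closure operator on subsets of $E$ such that for all $X\subseteq E$ and $x,y\in E$: (1) $\mathrm{cx}(X)^\ast=\mathrm{cx}(X^\ast)$; (2) if $x\in\mathrm{cx}(X\cup\{x^\ast\})$ then $x\in\mathrm{cx}(X)$; (3) if $x\in\mathrm{cx}(X\cup\{y^\ast\})$ and $x\notin\mathrm{cx}(X)$ then $y\in\mathrm{cx}((X\setminus\{y\})\cup\{x^\ast\})$; (4) if $x\in\mathrm{cx}(X)$ then $x\in\mathrm{cx}(Y)$ for some finite $Y\subseteq X$. It is reduced if $\mathrm{cx}(\varnothing)=\varnothing$ and $\mathrm{cx}(\{x\})=\{x\}$ for all $x\in E$. **Oriented matroid root systems.** An oriented matroid root system (OMRS) for $W$ is a reduced oriented matroid $(\overline{\Phi},\ast,d)$ such that: (i) $d(wX)=w\,d(X)$ for all $X\subseteq\overline{\Phi}$, $w\in W$; (ii) $d(\overline{\Phi}^+)=\overline{\Phi}^+$; (iii) if $X\subseteq\overline{\Phi}$ has linear span of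 dimension at most $2$, then $d(X)=\operatorname{cone}_\Phi(X)$. -}

module Defs where

open import Algebra.Bundles using (CommutativeRing)
open import Algebra.Module.Bundles using (Module)
import Algebra.Definitions.RawMonoid as RawMonoidDefs
import Algebra.Module.Properties as ModuleProperties
import Algebra.Properties.AbelianGroup as AbelianGroupProperties
import Algebra.Properties.Ring as RingProperties
open import Data.Empty using (⊥; ⊥-elim)
open import Data.Fin.Base using (Fin; zero; suc)
open import Data.List.Base using (List; []; _∷_; _++_; foldr)
import Data.List.Membership.Setoid as SetoidMembership
open import Data.Nat.Base as ℕ using (ℕ; zero; suc)
open import Data.Product.Base using (Σ; Σ-syntax; ∃-syntax; _×_; _,_; proj₁)
open import Data.Sum.Base using (_⊎_; inj₁; inj₂)
open import Data.Vec.Functional using (Vector)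
open import Level using (0ℓ)
open import Relation.Binary.Bundles using (Setoid)
open import Relation.Binary.Core using (Rel)
open import Relation.Binary.Definitions using (tri<; tri≈; tri>; _Respects_)
open import Relation.Binary.PropositionalEquality.Core using (_≡_; _≢_)
open import Relation.Binary.Structures using (IsStrictTotalOrder)
import Relation.Binary.Construct.StrictToNonStrict as NonStrict
open import Relation.Nullary.Negation.Core using (¬_)
open import Relation.Unary using (Pred; Satisfiable)

-- ℝ is an arbitrary Dedekind-complete ordered field; classically there is
-- exactly one up to isomorphism.  The value of 0# ⁻¹ is unspecified.

record RealField : Set₁ where
  infix 4 _<_
  infix 8 _⁻¹
  field
    commutativeRing    : CommutativeRing 0ℓ 0ℓ

  open CommutativeRing commutativeRing public hiding (zero)

  field
    _<_                : Rel Carrier 0ℓ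
    isStrictTotalOrder : IsStrictTotalOrder _≈_ _<_
    +-monoˡ-<          : ∀ {x y} z → x < y → x + z < y + z
    *-pos              : ∀ {x y} → 0# < x → 0# < y → 0# < x * y
    0≉1                : ¬ (0# ≈ 1#)
    _⁻¹                : Carrier → Carrier
    ⁻¹-cong            : ∀ {x y} → x ≈ y → x ⁻¹ ≈ y ⁻¹
    ⁻¹-inverse         : ∀ {x} → ¬ (x ≈ 0#) → x * x ⁻¹ ≈ 1#

  open NonStrict _≈_ _<_ public using (_≤_)

  UpperBound : Pred Carrier 0ℓ → Pred Carrier 0ℓ
  UpperBound A b = ∀ {x} → A x → x ≤ b

  field
    supremum           : (A : Pred Carrier 0ℓ) → Satisfiable A →
                         Satisfiable (UpperBound A) →
                         ∃[ s ] UpperBound A s × (∀ {b} → UpperBound A b → s ≤ b)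

  open RawMonoidDefs +-rawMonoid public using () renaming (_×_ to _·_)

  fromℕ : ℕ → Carrier
  fromℕ m = m · 1#

  IsSqrt : Carrier → Carrier → Set
  IsSqrt x r = 0# ≤ r × r * r ≈ x

-- Apostol's axioms for the sine and cosine (Calculus, vol. I, §2.5), which
-- determine cos, sin and π uniquely.  The axiom 0# < π is tacit there.

record Trigonometry (ℝ : RealField) : Set where
  open RealField ℝ
  field
    cos sin  : Carrier → Carrier
    π        : Carrier
    cos-cong : ∀ {x y} → x ≈ y → cos x ≈ cos y
    sin-cong : ∀ {x y} → x ≈ y → sin x ≈ sin y
    0<π      : 0# < π

  π/2 : Carrier
  π/2 = π * fromℕ 2 ⁻¹

  field
    cos-0    : cos 0# ≈ 1#
    sin-π/2  : sin π/2 ≈ 1#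
    cos-π    : cos π ≈ - 1#
    cos-diff : ∀ x y → cos (y - x) ≈ cos y * cos x + sin y * sin x
    bounds   : ∀ {x} → 0# < x → x < π/2 →
               0# < cos x × cos x < sin x * x ⁻¹ × sin x * x ⁻¹ < cos x ⁻¹

IsFinite : (S : Setoid 0ℓ 0ℓ) → Pred (Setoid.Carrier S) 0ℓ → Set
IsFinite S P = ∃[ xs ] (∀ {x} → P x → x ∈ xs)
  where open SetoidMembership S using (_∈_)

record Subset (S : Setoid 0ℓ 0ℓ) : Set₁ where
  constructor subset
  field
    mem  : Pred (Setoid.Carrier S) 0ℓ
    resp : mem Respects (Setoid._≈_ S)

module SubsetOps (S : Setoid 0ℓ 0ℓ) where
  open Setoid S

  infix 4 _∈_ _∉_ _⊆_ _≐_
  infixl 6 _∪_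
  infixl 7 _∖_

  _∈_ _∉_ : Carrier → Subset S → Set
  x ∈ X = Subset.mem X x
  x ∉ X = ¬ (x ∈ X)

  _⊆_ _≐_ : Subset S → Subset S → Set
  X ⊆ Y = ∀ {x} → x ∈ X → x ∈ Y
  X ≐ Y = X ⊆ Y × Y ⊆ X

  ∅ : Subset S
  ∅ = subset (λ _ → ⊥) (λ _ ())

  ｛_｝ : Carrier → Subset S
  ｛ x ｝ = subset (_≈ x) (λ y≈z y≈x → trans (sym y≈z) y≈x)

  _∪_ : Subset S → Subset S → Subset S
  X ∪ Y = subset (λ x → x ∈ X ⊎ x ∈ Y)
    λ { x≈y (inj₁ p) → inj₁ (Subset.resp X x≈y p)
      ; x≈y (inj₂ p) → inj₂ (Subset.resp Y x≈y p) }

  _∖_ : Subset S → Subset S → Subset S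
  X ∖ Y = subset (λ x → x ∈ X × x ∉ Y)
    λ { x≈y (p , q) → Subset.resp X x≈y p , λ r → q (Subset.resp Y (sym x≈y) r) }

  image : (Carrier → Carrier) → Subset S → Subset S
  image f X = subset (λ y → ∃[ x ] x ∈ X × y ≈ f x)
    λ { y≈z (x , p , e) → x , p , trans (sym y≈z) e }

  Finite : Subset S → Set
  Finite X = IsFinite S (Subset.mem X)

module _ (S : Setoid 0ℓ 0ℓ) where
  open Setoid S using (Carrier; _≈_)
  open SubsetOps S

  record IsClosureOperator (cx : Subset S → Subset S) : Set₁ where
    field
      extensive  : ∀ X → X ⊆ cx X
      monotone   : ∀ {X Y} → X ⊆ Y → cx X ⊆ cx Y
      idempotent : ∀ X → cx (cx X) ≐ cx X

  record IsOrientedMatroid (_* : Carrier → Carrier)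
                           (cx : Subset S → Subset S) : Set₁ where
    field
      *-cong            : ∀ {x y} → x ≈ y → x * ≈ y *
      *-involutive      : ∀ x → (x *) * ≈ x
      *-fixedPointFree  : ∀ x → ¬ (x * ≈ x)
      isClosureOperator : IsClosureOperator cx
      cx-*              : ∀ X → image _* (cx X) ≐ cx (image _* X)
      cx-absorb         : ∀ X x → x ∈ cx (X ∪ ｛ x * ｝) → x ∈ cx X
      cx-exchange       : ∀ X x y → x ∈ cx (X ∪ ｛ y * ｝) → x ∉ cx X →
                          y ∈ cx ((X ∖ ｛ y ｝) ∪ ｛ x * ｝)
      cx-finitary       : ∀ X x → x ∈ cx X →
                          ∃[ Y ] Finite Y × Y ⊆ X × x ∈ cx Y

  record IsReduced (cx : Subset S → Subset S) : Set₁ where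
    field
      cx-∅         : cx ∅ ≐ ∅
      cx-singleton : ∀ x → cx ｛ x ｝ ≐ ｛ x ｝

module LinearAlgebra (ℝ : RealField)
                     (V : Module (RealField.commutativeRing ℝ) 0ℓ 0ℓ) where
  open RealField ℝ
  open Module V
  open RawMonoidDefs +ᴹ-rawMonoid public using (sum)

  combination : ∀ {k} → Vector Carrier k → Vector Carrierᴹ k → Carrierᴹ
  combination c a = sum (λ i → c i *ₗ a i)

  NonNegative : ∀ {k} → Vector Carrier k → Set
  NonNegative c = ∀ i → 0# ≤ c i

  Span Cone : Pred Carrierᴹ 0ℓ → Pred Carrierᴹ 0ℓ
  Span A v = ∃[ k ] Σ[ c ∈ Vector Carrier k ] Σ[ a ∈ Vector Carrierᴹ k ]
             (∀ i → A (a i)) × v ≈ᴹ combination c a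
  Cone A v = ∃[ k ] Σ[ c ∈ Vector Carrier k ] Σ[ a ∈ Vector Carrierᴹ k ]
             NonNegative c × (∀ i → A (a i)) × v ≈ᴹ combination c a

  -- For a subspace U this says dim U ≤ k, since b may have repetitions.
  DimensionAtMost : ℕ → Pred Carrierᴹ 0ℓ → Set
  DimensionAtMost k U =
    Σ[ b ∈ Vector Carrierᴹ k ] (∀ i → U (b i)) ×
    (∀ {v} → U v → ∃[ c ] v ≈ᴹ combination c b)

  FiniteDimensional : Set
  FiniteDimensional =
    ∃[ k ] Σ[ b ∈ Vector Carrierᴹ k ] ∀ v → ∃[ c ] v ≈ᴹ combination c b

  *ₗ-combination : ∀ {k} x (c : Vector Carrier k) a →
                   x *ₗ combination c a ≈ᴹ combination (λ i → x * c i) a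
  *ₗ-combination {zero}  x c a = *ₗ-zeroʳ x
  *ₗ-combination {suc k} x c a = ≈ᴹ-trans (*ₗ-distribˡ x _ _)
    (+ᴹ-cong (≈ᴹ-sym (*ₗ-assoc x (c zero) (a zero)))
             (*ₗ-combination x (λ i → c (suc i)) (λ i → a (suc i))))

module OrderedFieldLemmas (ℝ : RealField) where
  open RealField ℝ
  open IsStrictTotalOrder isStrictTotalOrder
    using (compare; irrefl; <-respˡ-≈; <-respʳ-≈) renaming (trans to <-trans)
  open RingProperties ring using (-‿distribˡ-*; -‿distribʳ-*; -0#≈0#; -‿involutive)

  neg-pos : ∀ {x} → x < 0# → 0# < - x
  neg-pos {x} x<0 = <-respˡ-≈ (-‿inverseʳ x)
    (<-respʳ-≈ (+-identityˡ (- x)) (+-monoˡ-< (- x) x<0))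

  0<1 : 0# < 1#
  0<1 with compare 0# 1#
  ... | tri< p _ _ = p
  ... | tri≈ _ p _ = ⊥-elim (0≉1 p)
  ... | tri> _ _ p = <-respʳ-≈ -1*-1≈1 (*-pos (neg-pos p) (neg-pos p))
    where
    -1*-1≈1 : - 1# * - 1# ≈ 1#
    -1*-1≈1 = trans (sym (-‿distribˡ-* 1# (- 1#)))
      (trans (-‿cong (*-identityˡ (- 1#))) (-‿involutive 1#))

  pos⇒≉0 : ∀ {x} → 0# < x → ¬ (x ≈ 0#)
  pos⇒≉0 p e = irrefl (sym e) p

  ⁻¹-inverseˡ : ∀ {x} → ¬ (x ≈ 0#) → x ⁻¹ * x ≈ 1#
  ⁻¹-inverseˡ n = trans (*-comm _ _) (⁻¹-inverse n)

  ⁻¹-pos : ∀ {x} → 0# < x → 0# < x ⁻¹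
  ⁻¹-pos {x} p with compare 0# (x ⁻¹)
  ... | tri< q _ _ = q
  ... | tri≈ _ q _ = ⊥-elim (0≉1 (trans (sym (zeroʳ x))
                       (trans (*-congˡ q) (⁻¹-inverse (pos⇒≉0 p)))))
  ... | tri> _ _ q = ⊥-elim (irrefl refl (<-trans 0<1
      (<-respʳ-≈ (-‿inverseˡ 1#) (<-respˡ-≈ (+-identityˡ 1#) (+-monoˡ-< 1# 0<-1)))))
    where
    0<-1 : 0# < - 1#
    0<-1 = <-respʳ-≈
      (trans (sym (-‿distribʳ-* x (x ⁻¹))) (-‿cong (⁻¹-inverse (pos⇒≉0 p))))
      (*-pos p (neg-pos q))

  *-nonneg : ∀ {x y} → 0# < x → 0# ≤ y → 0# ≤ x * y
  *-nonneg p (inj₁ q) = inj₁ (*-pos p q)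
  *-nonneg p (inj₂ q) = inj₂ (sym (trans (*-congˡ (sym q)) (zeroʳ _)))

record RootSystem (ℝ : RealField) (trig : Trigonometry ℝ) : Set₁ where
  open RealField ℝ
  open Trigonometry trig
  field
    V                     : Module commutativeRing 0ℓ 0ℓ

  open Module V public
  open LinearAlgebra ℝ V public

  -- The set {- cos (π/m) : m ∈ ℤ, m ≥ 2} ∪ (-∞, -1].
  AdmissibleCosine : Pred Carrier 0ℓ
  AdmissibleCosine x =
    (∃[ m ] 2 ℕ.≤ m × x ≈ - cos (π * fromℕ m ⁻¹)) ⊎ x ≤ - 1#

  field
    finiteDimensional     : FiniteDimensional

    ⟨_,_⟩                 : Carrierᴹ → Carrierᴹ → Carrier
    ⟨⟩-cong               : ∀ {u u′ v v′} → u ≈ᴹ u′ → v ≈ᴹ v′ → ⟨ u , v ⟩ ≈ ⟨ u′ , v′ ⟩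
    ⟨⟩-sym                : ∀ u v → ⟨ u , v ⟩ ≈ ⟨ v , u ⟩
    ⟨⟩-+                  : ∀ u u′ v → ⟨ u +ᴹ u′ , v ⟩ ≈ ⟨ u , v ⟩ + ⟨ u′ , v ⟩
    ⟨⟩-*                  : ∀ x u v → ⟨ x *ₗ u , v ⟩ ≈ x * ⟨ u , v ⟩

    -- The members of Π, listed without repetition.
    n                     : ℕ
    simple                : Vector Carrierᴹ n
    simple-injective      : ∀ {i j} → simple i ≈ᴹ simple j → i ≡ j
    positivelyIndependent : (c : Vector Carrier n) → NonNegative c →
                            combination c simple ≈ᴹ 0ᴹ → ∀ i → c i ≈ 0#
    simple-pos            : ∀ i → 0# < ⟨ simple i , simple i ⟩
    simple-angle          : ∀ {i j} → i ≢ j →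
      ∃[ r ] IsSqrt (⟨ simple i , simple i ⟩ * ⟨ simple j , simple j ⟩) r ×
             AdmissibleCosine (⟨ simple i , simple j ⟩ * r ⁻¹)

  s : Carrierᴹ → Carrierᴹ → Carrierᴹ
  s α v = v +ᴹ -ᴹ ((fromℕ 2 * ⟨ v , α ⟩ * ⟨ α , α ⟩ ⁻¹) *ₗ α)

  -- The simple reflections are involutions, so the elements of the group W
  -- they generate are exactly the transformations `act w` for w a word.
  Word : Set
  Word = List (Fin n)

  act : Word → Carrierᴹ → Carrierᴹ
  act w v = foldr (λ i → s (simple i)) v w

  Π Φ Φ⁺ : Pred Carrierᴹ 0ℓ
  Π v = ∃[ i ] v ≈ᴹ simple i
  Φ v = Σ[ w ∈ Word ] ∃[ i ] v ≈ᴹ act w (simple i)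
  Φ⁺ v = Φ v × Cone Π v

  Finite : Set
  Finite = IsFinite ≈ᴹ-setoid Φ

  Root : Set
  Root = Σ Carrierᴹ Φ

  open OrderedFieldLemmas ℝ
  open ModuleProperties V using (inverseˡ-uniqueᴹ; inverseʳ-uniqueᴹ)
  open RingProperties ring using (-‿distribˡ-*; -‿involutive)
  open AbelianGroupProperties +ᴹ-abelianGroup using ()
    renaming (⁻¹-∙-comm to -ᴹ-+ᴹ-comm)

  *ₗ-negˡ : ∀ x v → (- x) *ₗ v ≈ᴹ -ᴹ (x *ₗ v)
  *ₗ-negˡ x v = inverseˡ-uniqueᴹ _ _ (≈ᴹ-trans (≈ᴹ-sym (*ₗ-distribʳ v (- x) x))
    (≈ᴹ-trans (*ₗ-cong (-‿inverseˡ x) ≈ᴹ-refl) (*ₗ-zeroˡ v)))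

  -1*ₗ : ∀ v → (- 1#) *ₗ v ≈ᴹ -ᴹ v
  -1*ₗ v = ≈ᴹ-trans (*ₗ-negˡ 1# v) (-ᴹ‿cong (*ₗ-identityˡ v))

  ⟨⟩-neg : ∀ u v → ⟨ -ᴹ u , v ⟩ ≈ - ⟨ u , v ⟩
  ⟨⟩-neg u v = trans (⟨⟩-cong (≈ᴹ-sym (-1*ₗ u)) ≈ᴹ-refl) (trans (⟨⟩-* _ u v)
    (trans (sym (-‿distribˡ-* 1# _)) (-‿cong (*-identityˡ _))))

  s-cong : ∀ α {u v} → u ≈ᴹ v → s α u ≈ᴹ s α v
  s-cong α e = +ᴹ-cong e (-ᴹ‿cong
    (*ₗ-cong (*-congʳ (*-congˡ (⟨⟩-cong e ≈ᴹ-refl))) ≈ᴹ-refl))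

  s-neg : ∀ α v → s α (-ᴹ v) ≈ᴹ -ᴹ s α v
  s-neg α v = ≈ᴹ-trans (+ᴹ-cong ≈ᴹ-refl (-ᴹ‿cong
      (≈ᴹ-trans (*ₗ-cong coefficient ≈ᴹ-refl) (*ₗ-negˡ _ α))))
    (-ᴹ-+ᴹ-comm v _)
    where
    coefficient : fromℕ 2 * ⟨ -ᴹ v , α ⟩ * ⟨ α , α ⟩ ⁻¹ ≈
                  - (fromℕ 2 * ⟨ v , α ⟩ * ⟨ α , α ⟩ ⁻¹)
    coefficient = trans (*-congʳ (trans (*-congˡ (⟨⟩-neg v α))
        (trans (*-comm _ _) (trans (sym (-‿distribˡ-* _ _)) (-‿cong (*-comm _ _))))))
      (sym (-‿distribˡ-* _ _))

  s-self : ∀ α → 0# < ⟨ α , α ⟩ → s α α ≈ᴹ -ᴹ α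
  s-self α p = inverseˡ-uniqueᴹ _ _ (≈ᴹ-trans (+ᴹ-assoc _ _ _)
    (≈ᴹ-trans (+ᴹ-cong ≈ᴹ-refl (+ᴹ-comm _ _)) (≈ᴹ-trans (≈ᴹ-sym (+ᴹ-assoc _ _ _))
    (≈ᴹ-trans (+ᴹ-cong (≈ᴹ-sym twice) ≈ᴹ-refl) (-ᴹ‿inverseʳ _)))))
    where
    coefficient : fromℕ 2 * ⟨ α , α ⟩ * ⟨ α , α ⟩ ⁻¹ ≈ 1# + 1#
    coefficient = trans (*-assoc _ _ _) (trans (*-congˡ (⁻¹-inverse (pos⇒≉0 p)))
      (trans (*-identityʳ _) (+-congˡ (+-identityʳ 1#))))
    twice : (fromℕ 2 * ⟨ α , α ⟩ * ⟨ α , α ⟩ ⁻¹) *ₗ α ≈ᴹ α +ᴹ α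
    twice = ≈ᴹ-trans (*ₗ-cong coefficient ≈ᴹ-refl) (≈ᴹ-trans (*ₗ-distribʳ α 1# 1#)
      (+ᴹ-cong (*ₗ-identityˡ α) (*ₗ-identityˡ α)))

  act-neg-simple : ∀ w i → act (w ++ i ∷ []) (simple i) ≈ᴹ -ᴹ act w (simple i)
  act-neg-simple []      i = s-self (simple i) (simple-pos i)
  act-neg-simple (j ∷ w) i =
    ≈ᴹ-trans (s-cong (simple j) (act-neg-simple w i)) (s-neg (simple j) _)

  act-cong : ∀ w {u v} → u ≈ᴹ v → act w u ≈ᴹ act w v
  act-cong []      e = e
  act-cong (j ∷ w) e = s-cong (simple j) (act-cong w e)

  act-Φ : ∀ w {v} → Φ v → Φ (act w v)
  act-Φ w (w′ , i , e) = go w w′ i e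
    where
    go : ∀ w w′ i {v} → v ≈ᴹ act w′ (simple i) → Φ (act w v)
    go []      w′ i e = w′ , i , e
    go (j ∷ w) w′ i e with go w w′ i e
    ... | u , k , e′ = j ∷ u , k , s-cong (simple j) e′

  negate : Root → Root
  negate (v , w , i , e) = -ᴹ v , w ++ i ∷ [] , i ,
    ≈ᴹ-trans (-ᴹ‿cong e) (≈ᴹ-sym (act-neg-simple w i))

  translate : Word → Root → Root
  translate w (v , p) = act w v , act-Φ w p

  infix 4 _∼_
  _∼_ : Rel Root 0ℓ
  (u , _) ∼ (v , _) = ∃[ c ] 0# < c × v ≈ᴹ c *ₗ u

  -- The set of rays is the quotient of the set of roots by _∼_; its
  -- subsets are the subsets of Root saturated for _∼_.
  Rays : Setoid 0ℓ 0ℓ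
  Rays = record
    { Carrier       = Root
    ; _≈_           = _∼_
    ; isEquivalence = record
        { refl  = λ {α} → ∼-refl α
        ; sym   = λ {α} {β} → ∼-sym α β
        ; trans = λ {α} {β} {γ} → ∼-trans α β γ
        }
    }
    where
    ∼-refl : ∀ α → α ∼ α
    ∼-refl _ = 1# , 0<1 , ≈ᴹ-sym (*ₗ-identityˡ _)
    ∼-sym : ∀ α β → α ∼ β → β ∼ α
    ∼-sym _ _ (c , p , e) = c ⁻¹ , ⁻¹-pos p , ≈ᴹ-sym (≈ᴹ-trans (*ₗ-cong refl e)
      (≈ᴹ-trans (≈ᴹ-sym (*ₗ-assoc _ _ _))
      (≈ᴹ-trans (*ₗ-cong (⁻¹-inverseˡ (pos⇒≉0 p)) ≈ᴹ-refl) (*ₗ-identityˡ _))))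
    ∼-trans : ∀ α β γ → α ∼ β → β ∼ γ → α ∼ γ
    ∼-trans _ _ _ (c , p , e) (d , q , f) = d * c , *-pos q p ,
      ≈ᴹ-trans f (≈ᴹ-trans (*ₗ-cong refl e) (≈ᴹ-sym (*ₗ-assoc d c _)))

  open SubsetOps Rays

  Representatives : Subset Rays → Pred Carrierᴹ 0ℓ
  Representatives X v = Σ[ p ∈ Φ v ] (v , p) ∈ X

  coneΦ : Subset Rays → Subset Rays
  coneΦ X = subset (λ α → Cone (Representatives X) (proj₁ α))
    λ { (x , p , e) (k , c , a , nonneg , a∈X , f) →
        k , (λ i → x * c i) , a , (λ i → *-nonneg p (nonneg i)) , a∈X ,
        ≈ᴹ-trans e (≈ᴹ-trans (*ₗ-cong refl f) (*ₗ-combination x c a)) }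

  positiveRays : Subset Rays
  positiveRays = subset (λ α → Σ[ β ∈ Root ] Φ⁺ (proj₁ β) × α ∼ β)
    λ { {x = α} {y = α′} α∼α′ (β , p , α∼β) →
        β , p , Setoid.trans Rays {α′} {α} {β} (Setoid.sym Rays {α} {α′} α∼α′) α∼β }

  record IsOMRS (d : Subset Rays → Subset Rays) : Set₁ where
    field
      isOrientedMatroid : IsOrientedMatroid Rays negate d
      isReduced         : IsReduced Rays d
      equivariant       : ∀ X w → d (image (translate w) X) ≐ image (translate w) (d X)
      positive-closed   : d positiveRays ≐ positiveRays
      rank-two          : ∀ X → DimensionAtMost 2 (Span (Representatives X)) →
                          d X ≐ coneΦ X

{-# OPTIONS --safe #-}
module Submission where

-- Conical closure of rays is an oriented matroid root system.  For uniqueness,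
-- every such structure d is determined by the chambers wΦ⁺, which do not
-- depend on d:
-- * if x ∈ d X, then x ∈ d Y for some acyclic Y ⊆ X, one whose closure contains
--   no pair of opposite rays (Carathéodory);
-- * an acyclic set extends to a hemispace, a closed acyclic set meeting every
--   pair of opposite rays;
-- * every hemispace is a chamber: it contains wΦ⁺ = d (wΠ) as soon as it
--   contains wΠ, and otherwise crossing a wall wα brings wΦ⁺ closer to it;
-- * so for acyclic Y, x ∉ d Y if and only if some chamber contains Y and - x.
-- Both Φ = Φ⁺ ∪ - Φ⁺ and Φ⁺ ⊆ d Π come from one induction on the length of w
-- (Deodhar, Humphreys), showing that wα lies in every set of roots that
-- contains Π and is closed under cones of pairs, when w s_α is reduced.

open import Defs
open import Algebra.Bundles using (CommutativeMonoid; CommutativeRing)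
import Algebra.Definitions.RawMonoid as RawMonoidDefs
open import Algebra.Module.Bundles using (Module)
import Algebra.Module.Properties as ModuleProperties
import Algebra.Properties.AbelianGroup as AbelianGroupProperties
import Algebra.Properties.CommutativeSemigroup as CommutativeSemigroupProperties
import Algebra.Properties.Ring as RingProperties
import Algebra.Properties.Semiring.Mult as MultProperties
import Algebra.Solver.Ring as RingSolver
open import Algebra.Solver.Ring.AlmostCommutativeRing
  using (_-Raw-AlmostCommutative⟶_; fromCommutativeRing)
open import Axiom.ExcludedMiddle using (ExcludedMiddle)
open import Data.Empty using (⊥; ⊥-elim)
open import Data.Fin.Base using (Fin; zero; suc)
import Data.Fin.Properties as Finₚ
open import Data.Integer.Base as ℤ using (ℤ)
import Data.Integer.Properties as ℤₚ
open import Data.List.Base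
  using (List; []; _∷_; _++_; map; length; filter; reverse; initLast; _∷ʳ′_)
import Data.List.Membership.Setoid as SetoidMembership
open import Data.List.Membership.Setoid.Properties
  using (∈-resp-≈; ∈-map⁺; ∈-map⁻; ∈-filter⁺; ∈-filter⁻)
import Data.List.Properties as Listₚ
open import Data.List.Relation.Unary.Any using (here; there)
open import Data.Maybe.Base as Maybe using (Maybe)
open import Data.Nat.Base as ℕ using (ℕ; zero; suc; parity)
import Data.Nat.Properties as ℕₚ
import Data.Parity.Base as ℙ
import Data.Parity.Properties as ℙₚ
open import Data.Product.Base as Product
  using (Σ-syntax; ∃-syntax; _×_; _,_; proj₁; proj₂)
open import Data.Sum.Base as Sum using (_⊎_; inj₁; inj₂)
open import Data.Vec.Base using (Vec; []; _∷_; lookup)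
open import Data.Vec.Functional as Vector using (Vector)
open import Function.Base using (_∘_)
open import Level using (0ℓ)
open import Relation.Binary.Bundles using (Setoid)
open import Relation.Binary.Consequences using (dec⇒weaklyDec)
import Relation.Binary.Construct.StrictToNonStrict as NonStrict
open import Relation.Binary.Definitions using (tri<; tri≈; tri>)
open import Relation.Binary.PropositionalEquality.Core as ≡ using (_≡_; _≢_)
open import Relation.Binary.Structures using (IsStrictTotalOrder)
open import Relation.Nullary.Decidable.Core using (yes; no)
open import Relation.Nullary.Negation.Core using (¬_)
open import Relation.Unary using (Decidable; Pred)

-- The axioms prescribe `d` only on planar sets and on `positiveRays`, so for a general X nothing
-- relates d X to `coneΦ X` directly. The comparison runs through sets whose description does not
-- mention `d`: by equivariance every chamber is closed for every structure, so a subset of a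
-- chamber is acyclic for all structures at once, and acyclicity carries over from one structure to
-- another. Planar cones suffice to generate a chamber from the translates of the simple roots,
-- because in the induction over reduced words a new root is always a nonnegative combination of two
-- roots of shorter words. The coefficients are values of Chebyshev polynomials, and their signs are
-- where the admissible cosines enter. Finiteness of Φ supplies a list of all rays, which serves
-- both to extend an acyclic set to a hemispace and to bound the number of walls crossed on the way
-- to it.

-- Solvers for identities in rings and modules.

-- Ring identities over an abstract ring are normalised with coefficients
-- in ℤ, whose equality computes.
module IntegerCoefficients (R : CommutativeRing 0ℓ 0ℓ) where
  open CommutativeRing R hiding (zero)
  open RingProperties ring
    using (-‿distribˡ-*; -‿distribʳ-*; -0#≈0#; -‿involutive; -‿+-comm)
  open MultProperties semiring using (×-homo-+; ×1-homo-*) renaming (_×_ to _·_)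
  open import Relation.Binary.Reasoning.Setoid setoid

  ι : ℤ → Carrier
  ι (ℤ.+ n)    = n · 1#
  ι ℤ.-[1+ n ] = - (suc n · 1#)

  ι-⊖ : ∀ m n → ι (m ℤ.⊖ n) ≈ m · 1# + - (n · 1#)
  ι-⊖ m zero = trans (sym (+-identityʳ _)) (+-congˡ (sym -0#≈0#))
  ι-⊖ zero (suc n) = sym (+-identityˡ _)
  ι-⊖ (suc m) (suc n) = begin
    ι (suc m ℤ.⊖ suc n)                     ≡⟨ ≡.cong ι (ℤₚ.[1+m]⊖[1+n]≡m⊖n m n) ⟩
    ι (m ℤ.⊖ n)                             ≈⟨ ι-⊖ m n ⟩
    m · 1# + - (n · 1#)                     ≈⟨ +-congʳ (+-identityʳ _) ⟨
    m · 1# + 0# + - (n · 1#)                ≈⟨ +-congʳ (+-congˡ (-‿inverseʳ 1#)) ⟨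
    m · 1# + (1# + - 1#) + - (n · 1#)       ≈⟨ +-congʳ (+-assoc _ _ _) ⟨
    m · 1# + 1# + - 1# + - (n · 1#)         ≈⟨ +-assoc _ _ _ ⟩
    m · 1# + 1# + (- 1# + - (n · 1#))       ≈⟨ +-cong (+-comm _ _) (-‿+-comm _ _) ⟩
    suc m · 1# + - (suc n · 1#)             ∎

  ι-+ : ∀ i j → ι (i ℤ.+ j) ≈ ι i + ι j
  ι-+ (ℤ.+ m)    (ℤ.+ n)    = ×-homo-+ 1# m n
  ι-+ (ℤ.+ m)    ℤ.-[1+ n ] = ι-⊖ m (suc n)
  ι-+ ℤ.-[1+ m ] (ℤ.+ n)    = trans (ι-⊖ n (suc m)) (+-comm _ _)
  ι-+ ℤ.-[1+ m ] ℤ.-[1+ n ] = begin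
    - (suc (suc (m ℕ.+ n)) · 1#)    ≡⟨ ≡.cong (λ k → - (suc k · 1#)) (ℕₚ.+-suc m n) ⟨
    - ((suc m ℕ.+ suc n) · 1#)      ≈⟨ -‿cong (×-homo-+ 1# (suc m) (suc n)) ⟩
    - (suc m · 1# + suc n · 1#)     ≈⟨ -‿+-comm _ _ ⟨
    - (suc m · 1#) + - (suc n · 1#) ∎

  ι-neg : ∀ i → ι (ℤ.- i) ≈ - ι i
  ι-neg (ℤ.+ zero)  = sym -0#≈0#
  ι-neg (ℤ.+ suc n) = refl
  ι-neg ℤ.-[1+ n ]  = sym (-‿involutive _)

  ι-*-+ : ∀ m n → ι (ℤ.+ m ℤ.* ℤ.+ n) ≈ ι (ℤ.+ m) * ι (ℤ.+ n)
  ι-*-+ m n = trans (reflexive (≡.cong ι (≡.sym (ℤₚ.pos-* m n)))) (×1-homo-* m n)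

  ι-* : ∀ i j → ι (i ℤ.* j) ≈ ι i * ι j
  ι-* (ℤ.+ m) (ℤ.+ n) = ι-*-+ m n
  ι-* (ℤ.+ m) ℤ.-[1+ n ] = begin
    ι (ℤ.+ m ℤ.* ℤ.-[1+ n ])           ≡⟨ ≡.cong ι (ℤₚ.neg-distribʳ-* (ℤ.+ m) (ℤ.+ suc n)) ⟨
    ι (ℤ.- (ℤ.+ m ℤ.* ℤ.+ suc n))      ≈⟨ ι-neg (ℤ.+ m ℤ.* ℤ.+ suc n) ⟩
    - ι (ℤ.+ m ℤ.* ℤ.+ suc n)          ≈⟨ -‿cong (ι-*-+ m (suc n)) ⟩
    - (m · 1# * (suc n · 1#))          ≈⟨ -‿distribʳ-* _ _ ⟩
    m · 1# * - (suc n · 1#)            ∎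
  ι-* ℤ.-[1+ m ] (ℤ.+ n) = begin
    ι (ℤ.-[1+ m ] ℤ.* ℤ.+ n)           ≡⟨ ≡.cong ι (ℤₚ.neg-distribˡ-* (ℤ.+ suc m) (ℤ.+ n)) ⟨
    ι (ℤ.- (ℤ.+ suc m ℤ.* ℤ.+ n))      ≈⟨ ι-neg (ℤ.+ suc m ℤ.* ℤ.+ n) ⟩
    - ι (ℤ.+ suc m ℤ.* ℤ.+ n)          ≈⟨ -‿cong (ι-*-+ (suc m) n) ⟩
    - (suc m · 1# * (n · 1#))          ≈⟨ -‿distribˡ-* _ _ ⟩
    - (suc m · 1#) * (n · 1#)          ∎
  ι-* ℤ.-[1+ m ] ℤ.-[1+ n ] = begin
    (suc m ℕ.* suc n) · 1#             ≈⟨ ×1-homo-* (suc m) (suc n) ⟩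
    suc m · 1# * (suc n · 1#)          ≈⟨ -‿involutive _ ⟨
    - - (suc m · 1# * (suc n · 1#))    ≈⟨ -‿cong (-‿distribˡ-* _ _) ⟩
    - (- (suc m · 1#) * (suc n · 1#))  ≈⟨ -‿distribʳ-* _ _ ⟩
    - (suc m · 1#) * - (suc n · 1#)    ∎

  morphism : CommutativeRing.rawRing ℤₚ.+-*-commutativeRing
             -Raw-AlmostCommutative⟶ fromCommutativeRing R
  morphism = record
    { ⟦_⟧    = ι
    ; +-homo = ι-+
    ; *-homo = ι-*
    ; -‿homo = ι-neg
    ; 0-homo = refl
    ; 1-homo = +-identityʳ 1#
    }

  ι-≟ : ∀ i j → Maybe (ι i ≈ ι j)
  ι-≟ i j = Maybe.map (λ eq → reflexive (≡.cong ι eq)) (dec⇒weaklyDec ℤₚ._≟_ i j)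

  open RingSolver (CommutativeRing.rawRing ℤₚ.+-*-commutativeRing)
    (fromCommutativeRing R) morphism ι-≟ public

module LinearTerms (R : CommutativeRing 0ℓ 0ℓ) (M : Module R 0ℓ 0ℓ) where
  open CommutativeRing R hiding (zero)
  open Module M
  open IntegerCoefficients R
    using (Polynomial; con; _:+_; _:*_; :-_)
    renaming (⟦_⟧ to ⟦_⟧ₚ; ⟦_⟧↓ to ⟦_⟧ₚ↓; correct to correctₚ)
  open ModuleProperties M using (inverseˡ-uniqueᴹ)
  open RawMonoidDefs +ᴹ-rawMonoid using (sum)
  open import Relation.Binary.Reasoning.Setoid ≈ᴹ-setoid

  infixl 6 _⊕_
  infixr 7 _⊛_
  infix  8 ⊖_

  -- Scalars are ring polynomials in m variables and vectors are k atoms, so a vector identity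
  -- becomes k ring identities, one for the coefficient of each atom.
  data Term (m k : ℕ) : Set where
    #_  : Fin k → Term m k
    𝟎   : Term m k
    _⊕_ : Term m k → Term m k → Term m k
    _⊛_ : Polynomial m → Term m k → Term m k
    ⊖_  : Term m k → Term m k

  ⟦_⟧ : ∀ {m k} → Term m k → Vec Carrier m → Vec Carrierᴹ k → Carrierᴹ
  ⟦ # i ⟧   ρ σ = lookup σ i
  ⟦ 𝟎 ⟧     ρ σ = 0ᴹ
  ⟦ s ⊕ t ⟧ ρ σ = ⟦ s ⟧ ρ σ +ᴹ ⟦ t ⟧ ρ σ
  ⟦ p ⊛ t ⟧ ρ σ = ⟦ p ⟧ₚ ρ *ₗ ⟦ t ⟧ ρ σ
  ⟦ ⊖ t ⟧   ρ σ = -ᴹ ⟦ t ⟧ ρ σ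

  δ : ∀ {m k} → Fin k → Fin k → Polynomial m
  δ zero    zero    = con (ℤ.+ 1)
  δ zero    (suc j) = con (ℤ.+ 0)
  δ (suc i) zero    = con (ℤ.+ 0)
  δ (suc i) (suc j) = δ i j

  coefficient : ∀ {m k} → Term m k → Fin k → Polynomial m
  coefficient (# i)   j = δ i j
  coefficient 𝟎       j = con (ℤ.+ 0)
  coefficient (s ⊕ t) j = coefficient s j :+ coefficient t j
  coefficient (p ⊛ t) j = p :* coefficient t j
  coefficient (⊖ t)   j = :- coefficient t j

  linear : ∀ {k} → Vector Carrierᴹ k → Vector Carrier k → Carrierᴹ
  linear a c = sum (λ i → c i *ₗ a i)

  linear-cong : ∀ {k} (a : Vector Carrierᴹ k) {c d} → (∀ i → c i ≈ d i) →
                linear a c ≈ᴹ linear a d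
  linear-cong {zero}  a e = ≈ᴹ-refl
  linear-cong {suc k} a e = +ᴹ-cong (*ₗ-cong (e zero) ≈ᴹ-refl) (linear-cong (a ∘ suc) (λ i → e (suc i)))

  linear-0 : ∀ {k} (a : Vector Carrierᴹ k) → linear a (λ _ → 0#) ≈ᴹ 0ᴹ
  linear-0 {zero}  a = ≈ᴹ-refl
  linear-0 {suc k} a = ≈ᴹ-trans (+ᴹ-cong (*ₗ-zeroˡ _) (linear-0 (a ∘ suc))) (+ᴹ-identityˡ 0ᴹ)

  linear-+ : ∀ {k} (a : Vector Carrierᴹ k) c d →
             linear a c +ᴹ linear a d ≈ᴹ linear a (λ i → c i + d i)
  linear-+ {zero}  a c d = +ᴹ-identityˡ 0ᴹ
  linear-+ {suc k} a c d = ≈ᴹ-trans (interchange _ _ _ _)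
      (+ᴹ-cong (≈ᴹ-sym (*ₗ-distribʳ _ _ _)) (linear-+ (a ∘ suc) (c ∘ suc) (d ∘ suc)))
    where open CommutativeSemigroupProperties
            (CommutativeMonoid.commutativeSemigroup +ᴹ-commutativeMonoid)
            using (interchange)

  linear-* : ∀ {k} (a : Vector Carrierᴹ k) x c →
             x *ₗ linear a c ≈ᴹ linear a (λ i → x * c i)
  linear-* {zero}  a x c = *ₗ-zeroʳ x
  linear-* {suc k} a x c = ≈ᴹ-trans (*ₗ-distribˡ x _ _)
    (+ᴹ-cong (≈ᴹ-sym (*ₗ-assoc x _ _)) (linear-* (a ∘ suc) x (c ∘ suc)))

  linear-neg : ∀ {k} (a : Vector Carrierᴹ k) c → -ᴹ linear a c ≈ᴹ linear a (λ i → - c i)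
  linear-neg a c = ≈ᴹ-sym (inverseˡ-uniqueᴹ _ _ (begin
    linear a (λ i → - c i) +ᴹ linear a c  ≈⟨ linear-+ a _ c ⟩
    linear a (λ i → - c i + c i)          ≈⟨ linear-cong a (λ i → -‿inverseˡ (c i)) ⟩
    linear a (λ _ → 0#)                   ≈⟨ linear-0 a ⟩
    0ᴹ                                    ∎))

  linear-δ : ∀ {m k} (ρ : Vec Carrier m) (a : Vector Carrierᴹ k) i →
             a i ≈ᴹ linear a (λ j → ⟦ δ i j ⟧ₚ ρ)
  linear-δ ρ a zero = ≈ᴹ-sym (≈ᴹ-trans (+ᴹ-cong
    (≈ᴹ-trans (*ₗ-cong (+-identityʳ 1#) ≈ᴹ-refl) (*ₗ-identityˡ _)) (linear-0 (a ∘ suc))) (+ᴹ-identityʳ _))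
  linear-δ ρ a (suc i) = ≈ᴹ-trans (linear-δ ρ (a ∘ suc) i)
    (≈ᴹ-sym (≈ᴹ-trans (+ᴹ-cong (*ₗ-zeroˡ _) ≈ᴹ-refl) (+ᴹ-identityˡ _)))

  correct : ∀ {m k} (t : Term m k) ρ σ → ⟦ t ⟧ ρ σ ≈ᴹ linear (lookup σ) (λ i → ⟦ coefficient t i ⟧ₚ ρ)
  correct (# i)   ρ σ = linear-δ ρ (lookup σ) i
  correct 𝟎       ρ σ = ≈ᴹ-sym (linear-0 (lookup σ))
  correct (s ⊕ t) ρ σ = ≈ᴹ-trans (+ᴹ-cong (correct s ρ σ) (correct t ρ σ)) (linear-+ (lookup σ) _ _)
  correct (p ⊛ t) ρ σ = ≈ᴹ-trans (*ₗ-cong refl (correct t ρ σ)) (linear-* (lookup σ) _ _)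
  correct (⊖ t)   ρ σ = ≈ᴹ-trans (-ᴹ‿cong (correct t ρ σ)) (linear-neg (lookup σ) _)

  -- The hypothesis compares normal forms of the coefficients. These compute, so it is discharged by
  -- `≡.refl`.
  proveᴹ : ∀ {m k} (ρ : Vec Carrier m) (σ : Vec Carrierᴹ k) (s t : Term m k) →
           linear (lookup σ) (λ i → ⟦ coefficient s i ⟧ₚ↓ ρ) ≡ linear (lookup σ) (λ i → ⟦ coefficient t i ⟧ₚ↓ ρ) →
           ⟦ s ⟧ ρ σ ≈ᴹ ⟦ t ⟧ ρ σ
  proveᴹ ρ σ s t eq = begin
    ⟦ s ⟧ ρ σ                                    ≈⟨ correct s ρ σ ⟩
    linear (lookup σ) (λ i → ⟦ coefficient s i ⟧ₚ ρ)      ≈⟨ linear-cong (lookup σ) (λ i → normal (coefficient s i)) ⟨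
    linear (lookup σ) (λ i → ⟦ coefficient s i ⟧ₚ↓ ρ)     ≡⟨ eq ⟩
    linear (lookup σ) (λ i → ⟦ coefficient t i ⟧ₚ↓ ρ)     ≈⟨ linear-cong (lookup σ) (λ i → normal (coefficient t i)) ⟩
    linear (lookup σ) (λ i → ⟦ coefficient t i ⟧ₚ ρ)      ≈⟨ correct t ρ σ ⟨
    ⟦ t ⟧ ρ σ                                    ∎
    where
    normal : ∀ p → ⟦ p ⟧ₚ↓ ρ ≈ ⟦ p ⟧ₚ ρ
    normal p = correctₚ p ρ

-- Ordered fields.

module OrderedField (ℝ : RealField) where
  open RealField ℝ
  open OrderedFieldLemmas ℝ public
  open IsStrictTotalOrder isStrictTotalOrder public
    using (compare; irrefl; <-resp-≈; <-respˡ-≈; <-respʳ-≈) renaming (trans to <-trans)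
  open IntegerCoefficients commutativeRing public using (solve; _:=_; con; var; _:+_; _:*_; :-_; _:-_)

  -- The literal 2 evaluates to `fromℕ 2` by definition, the form in which 2 occurs in reflections.
  two : ∀ {m} → IntegerCoefficients.Polynomial commutativeRing m
  two = con (ℤ.+ 2)

  ≤-refl : ∀ {x} → x ≤ x
  ≤-refl = inj₂ refl

  ≤-trans : ∀ {x y z} → x ≤ y → y ≤ z → x ≤ z
  ≤-trans = NonStrict.trans _≈_ _<_ isEquivalence <-resp-≈ <-trans

  <-≤-trans : ∀ {x y z} → x < y → y ≤ z → x < z
  <-≤-trans = NonStrict.<-≤-trans _≈_ _<_ <-trans <-respʳ-≈

  ≤-<-trans : ∀ {x y z} → x ≤ y → y < z → x < z
  ≤-<-trans = NonStrict.≤-<-trans _≈_ _<_ sym <-trans <-respˡ-≈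

  ≤-respˡ-≈ : ∀ {x y z} → x ≈ y → x ≤ z → y ≤ z
  ≤-respˡ-≈ = NonStrict.≤-respˡ-≈ _≈_ _<_ sym trans <-respˡ-≈

  ≤-respʳ-≈ : ∀ {x y z} → x ≈ y → z ≤ x → z ≤ y
  ≤-respʳ-≈ = NonStrict.≤-respʳ-≈ _≈_ _<_ trans <-respʳ-≈

  ≤-total : ∀ x y → x ≤ y ⊎ y ≤ x
  ≤-total = NonStrict.total _≈_ _<_ compare

  ≤⇒≯ : ∀ {x y} → x ≤ y → ¬ (y < x)
  ≤⇒≯ p q = irrefl refl (≤-<-trans p q)

  0≤1 : 0# ≤ 1#
  0≤1 = inj₁ 0<1

  +-monoˡ-≤ : ∀ {x y} z → x ≤ y → x + z ≤ y + z
  +-monoˡ-≤ z (inj₁ p) = inj₁ (+-monoˡ-< z p)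
  +-monoˡ-≤ z (inj₂ e) = inj₂ (+-congʳ e)

  +-nonneg : ∀ {x y} → 0# ≤ x → 0# ≤ y → 0# ≤ x + y
  +-nonneg {x} {y} p q = ≤-trans q (≤-respˡ-≈ (+-identityˡ y) (+-monoˡ-≤ y p))

  +-pos-nonneg : ∀ {x y} → 0# < x → 0# ≤ y → 0# < x + y
  +-pos-nonneg {x} {y} p q = ≤-<-trans q (<-respˡ-≈ (+-identityˡ y) (+-monoˡ-< y p))

  nonneg-* : ∀ {x y} → 0# ≤ x → 0# ≤ y → 0# ≤ x * y
  nonneg-* (inj₁ p) q = *-nonneg p q
  nonneg-* (inj₂ e) q = inj₂ (sym (trans (*-congʳ (sym e)) (zeroˡ _)))

  x≤y⇒0≤y-x : ∀ {x y} → x ≤ y → 0# ≤ y - x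
  x≤y⇒0≤y-x {x} p = ≤-respˡ-≈ (-‿inverseʳ x) (+-monoˡ-≤ (- x) p)

  x<y⇒0<y-x : ∀ {x y} → x < y → 0# < y - x
  x<y⇒0<y-x {x} p = <-respˡ-≈ (-‿inverseʳ x) (+-monoˡ-< (- x) p)

  0≤y-x⇒x≤y : ∀ {x y} → 0# ≤ y - x → x ≤ y
  0≤y-x⇒x≤y {x} {y} p = ≤-respˡ-≈ (+-identityˡ x)
    (≤-respʳ-≈ (solve 2 (λ x y → y :- x :+ x := y) refl x y) (+-monoˡ-≤ x p))

  0<y-x⇒x<y : ∀ {x y} → 0# < y - x → x < y
  0<y-x⇒x<y {x} {y} p = <-respˡ-≈ (+-identityˡ x)
    (<-respʳ-≈ (solve 2 (λ x y → y :- x :+ x := y) refl x y) (+-monoˡ-< x p))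

  *-cancelʳ : ∀ {x y z} → ¬ (z ≈ 0#) → x * z ≈ y * z → x ≈ y
  *-cancelʳ {x} {y} {z} z≉0 e = trans (sym (unit x)) (trans (*-congʳ e) (unit y))
    where
    unit : ∀ w → w * z * z ⁻¹ ≈ w
    unit w = trans (*-assoc w z _) (trans (*-congˡ (⁻¹-inverse z≉0)) (*-identityʳ w))

  *-pos-cancel : ∀ {x y} → 0# < y → 0# ≤ x * y → 0# ≤ x
  *-pos-cancel {x} {y} p q = ≤-respʳ-≈
    (trans (*-assoc x y _) (trans (*-congˡ (⁻¹-inverse (pos⇒≉0 p))) (*-identityʳ x)))
    (nonneg-* q (inj₁ (⁻¹-pos p)))

  square≈0 : ∀ {x} → x * x ≈ 0# → x ≈ 0#
  square≈0 {x} e with compare 0# x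
  ... | tri< p _ _ = ⊥-elim (pos⇒≉0 (*-pos p p) e)
  ... | tri≈ _ p _ = sym p
  ... | tri> _ _ p = ⊥-elim (pos⇒≉0 (*-pos (neg-pos p) (neg-pos p))
    (trans (solve 1 (λ x → (:- x) :* (:- x) := x :* x) refl x) e))

-- Lists as finite subsets, and counting.

module ListSubsets (S : Setoid 0ℓ 0ℓ) where
  open Setoid S
  open SubsetOps S
  open SetoidMembership S using () renaming (_∈_ to _∈ᴸ_)

  fromList : List Carrier → Subset S
  fromList xs = subset (_∈ᴸ xs) (∈-resp-≈ S)

  fromList-∷ : ∀ {x xs} → fromList (x ∷ xs) ⊆ fromList xs ∪ ｛ x ｝
  fromList-∷ (here e)  = inj₂ e
  fromList-∷ (there p) = inj₁ p

module Counting (em : ExcludedMiddle 0ℓ) (S : Setoid 0ℓ 0ℓ) where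
  open Setoid S
  open SubsetOps S
  open SetoidMembership S using () renaming (_∈_ to _∈ᴸ_)

  -- A termination measure: repeated entries are counted repeatedly, which is harmless since only
  -- strict decrease matters.
  count : Subset S → List Carrier → ℕ
  count X []       = 0
  count X (x ∷ xs) with em {P = x ∈ X}
  ... | yes _ = suc (count X xs)
  ... | no  _ = count X xs

  count-≤ : ∀ X Y → X ⊆ Y → ∀ xs → count X xs ℕ.≤ count Y xs
  count-≤ X Y X⊆Y []       = ℕ.z≤n
  count-≤ X Y X⊆Y (x ∷ xs) with em {P = x ∈ X} | em {P = x ∈ Y}
  ... | yes _   | yes _  = ℕ.s≤s (count-≤ X Y X⊆Y xs)
  ... | yes x∈X | no x∉Y = ⊥-elim (x∉Y (X⊆Y x∈X))
  ... | no _    | yes _  = ℕₚ.m≤n⇒m≤1+n (count-≤ X Y X⊆Y xs)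
  ... | no _    | no _   = count-≤ X Y X⊆Y xs

  count-< : ∀ X Y → X ⊆ Y → ∀ xs {z} → z ∈ᴸ xs → z ∈ Y → z ∉ X → count X xs ℕ.< count Y xs
  count-< X Y X⊆Y (x ∷ xs) z∈ z∈Y z∉X with em {P = x ∈ X} | em {P = x ∈ Y}
  count-< X Y X⊆Y (x ∷ xs) (here e) z∈Y z∉X | yes x∈X | _ = ⊥-elim (z∉X (Subset.resp X (sym e) x∈X))
  count-< X Y X⊆Y (x ∷ xs) (here e) z∈Y z∉X | no _ | yes _ = ℕ.s≤s (count-≤ X Y X⊆Y xs)
  count-< X Y X⊆Y (x ∷ xs) (here e) z∈Y z∉X | no _ | no x∉Y = ⊥-elim (x∉Y (Subset.resp Y e z∈Y))
  count-< X Y X⊆Y (x ∷ xs) (there z∈) z∈Y z∉X | yes _ | yes _ = ℕ.s≤s (count-< X Y X⊆Y xs z∈ z∈Y z∉X)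
  count-< X Y X⊆Y (x ∷ xs) (there z∈) z∈Y z∉X | yes x∈X | no x∉Y = ⊥-elim (x∉Y (X⊆Y x∈X))
  count-< X Y X⊆Y (x ∷ xs) (there z∈) z∈Y z∉X | no _ | yes _ =
    ℕₚ.m<n⇒m<1+n (count-< X Y X⊆Y xs z∈ z∈Y z∉X)
  count-< X Y X⊆Y (x ∷ xs) (there z∈) z∈Y z∉X | no _ | no _ = count-< X Y X⊆Y xs z∈ z∈Y z∉X

-- Acyclic sets in a reduced oriented matroid.

module ReducedOrientedMatroid
  (em : ExcludedMiddle 0ℓ) (S : Setoid 0ℓ 0ℓ)
  (_* : Setoid.Carrier S → Setoid.Carrier S)
  (cx : Subset S → Subset S)
  (isOrientedMatroid : IsOrientedMatroid S _* cx)
  (isReduced : IsReduced S cx)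
  where

  open Setoid S
  open SubsetOps S
  open SetoidMembership S using () renaming (_∈_ to _∈ᴸ_)
  open IsOrientedMatroid isOrientedMatroid
  open IsClosureOperator isClosureOperator
  open IsReduced isReduced
  open ListSubsets S

  cx-least : ∀ {X Y} → X ⊆ cx Y → cx X ⊆ cx Y
  cx-least {X} {Y} X⊆ x∈ = proj₁ (idempotent Y) (monotone {X} {cx Y} X⊆ x∈)

  cx-resp : ∀ X {x y} → x ≈ y → x ∈ cx X → y ∈ cx X
  cx-resp X = Subset.resp (cx X)

  Acyclic : Subset S → Set
  Acyclic X = ∀ x → x ∈ cx X → x * ∉ cx X

  acyclic-⊆ : ∀ {X Y} → X ⊆ cx Y → Acyclic Y → Acyclic X
  acyclic-⊆ {X} {Y} X⊆ acyclic x x∈ x*∈ =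
    acyclic x (cx-least {X} {Y} X⊆ x∈) (cx-least {X} {Y} X⊆ x*∈)

  -- Since x needs z, exchange expresses z * by X and x *. But x * lies in the closure of X and z,
  -- hence so does z *, and absorption removes z.
  opposite-pair : ∀ X z {x} → x ∈ cx (X ∪ ｛ z ｝) → x * ∈ cx (X ∪ ｛ z ｝) →
                  x ∉ cx X → z * ∈ cx X
  opposite-pair X z {x} x∈ x*∈ x∉ = cx-absorb X (z *) (z→z**
      (cx-least {(X ∖ ｛ z * ｝) ∪ ｛ x * ｝} {X ∪ ｛ z ｝}
        (λ { (inj₁ (p , _)) → extensive (X ∪ ｛ z ｝) (inj₁ p)
           ; (inj₂ e)       → cx-resp (X ∪ ｛ z ｝) (sym e) x*∈ })
        (cx-exchange X x (z *) (z→z** x∈) x∉)))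
    where
    z→z** : cx (X ∪ ｛ z ｝) ⊆ cx (X ∪ ｛ (z *) * ｝)
    z→z** = monotone {X ∪ ｛ z ｝} {X ∪ ｛ (z *) * ｝} λ
      { (inj₁ p) → inj₁ p
      ; (inj₂ e) → inj₂ (trans e (sym (*-involutive z))) }

  -- Of an opposite pair in the larger closure, at least one member lies outside `cx X`;
  -- `opposite-pair` applies to that member.
  acyclic-∪ : ∀ X z → Acyclic X → z * ∉ cx X → Acyclic (X ∪ ｛ z ｝)
  acyclic-∪ X z acyclic z*∉ x x∈ x*∈ with em {P = x ∈ cx X}
  ... | no x∉    = z*∉ (opposite-pair X z x∈ x*∈ x∉)
  ... | yes x∈X = z*∉ (opposite-pair X z x*∈
    (cx-resp (X ∪ ｛ z ｝) (sym (*-involutive x)) x∈) (acyclic x x∈X))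

  -- Only the entry to which the membership proof points is deleted, so the length drops by exactly
  -- one. Other entries equivalent to y may survive, hence two inclusions instead of an equality.
  without : ∀ {y xs} → y ∈ᴸ xs → Σ[ ys ∈ List Carrier ]
            length xs ≡ suc (length ys) ×
            fromList ys ⊆ fromList xs × fromList xs ∖ ｛ y ｝ ⊆ fromList ys
  without {xs = x ∷ xs} (here y≈x) = xs , ≡.refl , there , λ
    { (here z≈x , z≉y) → ⊥-elim (z≉y (trans z≈x (sym y≈x)))
    ; (there p  , _)   → p }
  without {xs = x ∷ xs} (there y∈) with without y∈
  ... | ys , eq , ys⊆ , xs⊆ = x ∷ ys , ≡.cong suc eq ,
    (λ { (here e) → here e ; (there p) → there (ys⊆ p) }) , λ
    { (here e  , _)   → here e
    ; (there p , z≉y) → there (xs⊆ (p , z≉y)) }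

  NoOpposite : Subset S → Set
  NoOpposite X = ¬ (∃[ x ] x ∈ X × x * ∈ cx X)

  -- `NoOpposite` tests generators only. Adding them one at a time, `acyclic-∪` could fail only at a
  -- y whose opposite is in the closure of the others, which is excluded.
  noOpposite⇒acyclic : ∀ xs → NoOpposite (fromList xs) → Acyclic (fromList xs)
  noOpposite⇒acyclic xs none = go xs (λ p → p)
    where
    go : ∀ ys → fromList ys ⊆ fromList xs → Acyclic (fromList ys)
    go []       _   x x∈ _ = proj₁ cx-∅ (monotone {fromList []} {∅} (λ ()) x∈)
    go (y ∷ ys) ⊆xs = acyclic-⊆ {fromList (y ∷ ys)} {fromList ys ∪ ｛ y ｝}
      (λ p → extensive (fromList ys ∪ ｛ y ｝) (fromList-∷ p))
      (acyclic-∪ (fromList ys) y (go ys (λ p → ⊆xs (there p)))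
        (λ y*∈ → none (y , ⊆xs (here refl) ,
          monotone {fromList ys} {fromList xs} (λ p → ⊆xs (there p)) y*∈)))

  -- Signed elimination: x ∈ cx Y and x ∈ cx ((Y ∖ y) ∪ N), with N made of
  -- opposites of elements of Y.  If the element y′ * of N is needed in the
  -- second relation, then exchanging it for x expresses y′, which is thereby
  -- eliminated from the first.
  eliminate : ∀ Y x → x ∈ cx Y → ∀ ns → (∀ {z} → z ∈ᴸ ns → z * ∈ Y) →
              ∀ y → y ∈ Y → x ∈ cx ((Y ∖ ｛ y ｝) ∪ fromList ns) →
              ∃[ y′ ] y′ ∈ Y × x ∈ cx (Y ∖ ｛ y′ ｝)
  eliminate Y x x∈Y []       _  y y∈ x∈ = y , y∈ ,
    monotone {(Y ∖ ｛ y ｝) ∪ fromList []} {Y ∖ ｛ y ｝} (λ { (inj₁ p) → p ; (inj₂ ()) }) x∈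
  eliminate Y x x∈Y (z ∷ ns) ⊆Y y y∈ x∈ with em {P = x ∈ cx ((Y ∖ ｛ y ｝) ∪ fromList ns)}
  ... | yes x∈′ = eliminate Y x x∈Y ns (λ p → ⊆Y (there p)) y y∈ x∈′
  -- Substituting for y′ in the first relation leaves x * among the generators, and absorption
  -- removes it. The new second relation omits y′ instead of y and has one negative fewer.
  ... | no  x∉  = eliminate Y x x∈Y ns (λ p → ⊆Y (there p)) y′ (⊆Y (here refl))
    (cx-absorb B x (cx-least {Y} {B ∪ ｛ x * ｝} Y⊆ x∈Y))
    where
    y′ : Carrier
    y′ = z *
    A B : Subset S
    A = (Y ∖ ｛ y ｝) ∪ fromList ns
    B = (Y ∖ ｛ y′ ｝) ∪ fromList ns
    y′∈ : y′ ∈ cx ((A ∖ ｛ y′ ｝) ∪ ｛ x * ｝)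
    y′∈ = cx-exchange A x y′
      (monotone {(Y ∖ ｛ y ｝) ∪ fromList (z ∷ ns)} {A ∪ ｛ y′ * ｝}
        (λ { (inj₁ p)         → inj₁ (inj₁ p)
           ; (inj₂ (here e))  → inj₂ (trans e (sym (*-involutive z)))
           ; (inj₂ (there p)) → inj₁ (inj₂ p) }) x∈)
      x∉
    Y⊆ : Y ⊆ cx (B ∪ ｛ x * ｝)
    Y⊆ {w} w∈ with em {P = w ≈ y′}
    ... | no w≉y′  = extensive (B ∪ ｛ x * ｝) (inj₁ (inj₁ (w∈ , w≉y′)))
    ... | yes w≈y′ = cx-resp (B ∪ ｛ x * ｝) (sym w≈y′)
      (monotone {(A ∖ ｛ y′ ｝) ∪ ｛ x * ｝} {B ∪ ｛ x * ｝}
        (λ { (inj₁ (inj₁ (p , _) , ≉y′)) → inj₁ (inj₁ (p , ≉y′))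
           ; (inj₁ (inj₂ p , _))         → inj₁ (inj₂ p)
           ; (inj₂ e)                    → inj₂ e })
        y′∈)

  -- If y is in the list X and y * in its closure, then y lies in the closure of the opposites of X
  -- by `cx-*`. Replacing y accordingly gives a relation for x to which `eliminate` applies, so a
  -- shorter list still has x in its closure.
  acyclic-support-fromList : ∀ k xs → length xs ≡ k → ∀ x → x ∈ cx (fromList xs) →
    Σ[ Y ∈ Subset S ] Y ⊆ fromList xs × Acyclic Y × x ∈ cx Y
  acyclic-support-fromList k xs len x x∈ with em {P = ∃[ y ] y ∈ fromList xs × y * ∈ cx (fromList xs)}
  ... | no none = fromList xs , (λ p → p) , noOpposite⇒acyclic xs none , x∈
  ... | yes (y , y∈ , y*∈) = smaller k len
    (eliminate X x x∈ (map _* xs) negatives y y∈ (cx-least {X} {Z} X⊆ x∈))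
    where
    X Z : Subset S
    X = fromList xs
    Z = (X ∖ ｛ y ｝) ∪ fromList (map _* xs)
    negatives : ∀ {z} → z ∈ᴸ map _* xs → z * ∈ X
    negatives z∈ with ∈-map⁻ S S z∈
    ... | w , w∈ , z≈w* = ∈-resp-≈ S
      (trans (sym (*-involutive w)) (*-cong (sym z≈w*))) w∈
    X⊆ : X ⊆ cx Z
    X⊆ {z} z∈ with em {P = z ≈ y}
    ... | no z≉y  = extensive Z (inj₁ (z∈ , z≉y))
    ... | yes z≈y = monotone {image _* X} {Z}
      (λ { (w , w∈ , e) → inj₂ (∈-resp-≈ S (sym e) (∈-map⁺ S S *-cong w∈)) })
      (proj₁ (cx-* X) (y * , y*∈ , trans z≈y (sym (*-involutive y))))
    smaller : ∀ k → length xs ≡ k → ∃[ y′ ] y′ ∈ X × x ∈ cx (X ∖ ｛ y′ ｝) →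
              Σ[ Y ∈ Subset S ] Y ⊆ X × Acyclic Y × x ∈ cx Y
    smaller k len (y′ , y′∈ , x∈′) with without y′∈
    smaller zero len _ | ys , eq , _ with ≡.trans (≡.sym eq) len
    ... | ()
    smaller (suc k) len (y′ , y′∈ , x∈′) | ys , eq , ys⊆ , xs⊆
      with acyclic-support-fromList k ys (ℕₚ.suc-injective (≡.trans (≡.sym eq) len)) x
             (monotone {X ∖ ｛ y′ ｝} {fromList ys} xs⊆ x∈′)
    ... | Y , Y⊆ , acyclic , x∈Y = Y , (λ p → ys⊆ (Y⊆ p)) , acyclic , x∈Y

  -- The oriented form of Carathéodory's theorem.
  acyclic-support : ∀ X x → x ∈ cx X → Σ[ Y ∈ Subset S ] Y ⊆ X × Acyclic Y × x ∈ cx Y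
  acyclic-support X x x∈ with cx-finitary X x x∈
  -- The list witnessing finiteness merely covers Y; filtering it keeps the support inside X.
  ... | Y , (xs , Y⊆xs) , Y⊆X , x∈Y =
    let Z , Z⊆ , acyclic , x∈Z = acyclic-support-fromList _ ys ≡.refl x
          (monotone {Y} {fromList ys} (λ p → ∈-filter⁺ S Y? (Subset.resp Y) (Y⊆xs p) p) x∈Y)
    in Z , (λ p → Y⊆X (proj₂ (∈-filter⁻ S Y? (Subset.resp Y) {xs = xs} (Z⊆ p)))) , acyclic , x∈Z
    where
    Y? : Decidable (_∈ Y)
    Y? _ = em
    ys : List Carrier
    ys = filter Y? xs

  CompleteOn : List Carrier → Subset S → Set
  CompleteOn xs X = ∀ {x} → x ∈ᴸ xs → x ∈ cx X ⊎ x * ∈ cx X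

  -- Greedy choice: unless x * is already forced, adding x preserves acyclicity by `acyclic-∪`.
  hemispace-extension : ∀ xs X → Acyclic X →
    Σ[ Y ∈ Subset S ] X ⊆ cx Y × Acyclic Y × CompleteOn xs Y
  hemispace-extension []       X acyclic = X , extensive X , acyclic , λ ()
  hemispace-extension (x ∷ xs) X acyclic with hemispace-extension xs X acyclic
  ... | Y , X⊆ , acyclicY , complete with em {P = x * ∈ cx Y}
  ...   | yes x*∈ = Y , X⊆ , acyclicY , λ
    { (here e)  → inj₂ (cx-resp Y (*-cong (sym e)) x*∈)
    ; (there p) → complete p }
  ...   | no x*∉  = Y ∪ ｛ x ｝ , (λ p → up (X⊆ p)) , acyclic-∪ Y x acyclicY x*∉ , λ
    { (here e)  → inj₁ (extensive (Y ∪ ｛ x ｝) (inj₂ e))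
    ; (there p) → Sum.map up up (complete p) }
    where
    up : cx Y ⊆ cx (Y ∪ ｛ x ｝)
    up = monotone {Y} {Y ∪ ｛ x ｝} inj₁

-- Cones in a real vector space.

module Cones (ℝ : RealField) (V : Module (RealField.commutativeRing ℝ) 0ℓ 0ℓ) where
  open RealField ℝ
  open Module V
  open LinearAlgebra ℝ V
  open OrderedField ℝ
  open LinearTerms commutativeRing V using (#_; 𝟎; _⊕_; _⊛_; ⊖_; proveᴹ) public

  cone-resp : ∀ A {u v} → u ≈ᴹ v → Cone A u → Cone A v
  cone-resp A e (k , c , a , c≥0 , a∈ , f) = k , c , a , c≥0 , a∈ , ≈ᴹ-trans (≈ᴹ-sym e) f

  cone-0 : ∀ A → Cone A 0ᴹ
  cone-0 A = 0 , (λ ()) , (λ ()) , (λ ()) , (λ ()) , ≈ᴹ-refl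

  cone-∷ : ∀ A {x a v} → 0# ≤ x → A a → Cone A v → Cone A (x *ₗ a +ᴹ v)
  cone-∷ A {x} {a} x≥0 a∈A (k , c , b , c≥0 , b∈A , e) =
    suc k , x Vector.∷ c , a Vector.∷ b ,
    (λ { zero → x≥0 ; (suc i) → c≥0 i }) ,
    (λ { zero → a∈A ; (suc i) → b∈A i }) , +ᴹ-cong ≈ᴹ-refl e

  -- Cones treated as an inductive predicate, so that later arguments need not handle indexed
  -- families. Q must respect `≈ᴹ` because a member of the cone only equals its combination up to
  -- `≈ᴹ`.
  cone-rec : ∀ A (Q : Pred Carrierᴹ 0ℓ) → (∀ {u v} → u ≈ᴹ v → Q u → Q v) → Q 0ᴹ →
             (∀ {x a v} → 0# ≤ x → A a → Q v → Q (x *ₗ a +ᴹ v)) →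
             ∀ {v} → Cone A v → Q v
  cone-rec A Q resp base step (k , c , a , c≥0 , a∈ , e) = resp (≈ᴹ-sym e) (go k c a c≥0 a∈)
    where
    go : ∀ k c a → NonNegative c → (∀ i → A (a i)) → Q (combination {k} c a)
    go zero    c a _   _  = base
    go (suc k) c a c≥0 a∈ = step (c≥0 zero) (a∈ zero)
      (go k (λ i → c (suc i)) (λ i → a (suc i)) (λ i → c≥0 (suc i)) (λ i → a∈ (suc i)))

  cone-+ : ∀ A {u v} → Cone A u → Cone A v → Cone A (u +ᴹ v)
  cone-+ A {v = v} u∈ v∈ = cone-rec A (λ u → Cone A (u +ᴹ v))
    (λ e → cone-resp A (+ᴹ-cong e ≈ᴹ-refl)) (cone-resp A (≈ᴹ-sym (+ᴹ-identityˡ v)) v∈)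
    (λ x≥0 a∈ w∈ → cone-resp A (≈ᴹ-sym (+ᴹ-assoc _ _ _)) (cone-∷ A x≥0 a∈ w∈)) u∈

  cone-*ₗ : ∀ A {x v} → 0# ≤ x → Cone A v → Cone A (x *ₗ v)
  cone-*ₗ A {x} x≥0 (k , c , a , c≥0 , a∈ , e) =
    k , (λ i → x * c i) , a , (λ i → nonneg-* x≥0 (c≥0 i)) , a∈ ,
    ≈ᴹ-trans (*ₗ-cong refl e) (*ₗ-combination x c a)

  cone-∋ : ∀ A {a} → A a → Cone A a
  cone-∋ A {a} a∈ = cone-resp A (≈ᴹ-trans (+ᴹ-identityʳ _) (*ₗ-identityˡ a))
    (cone-∷ A 0≤1 a∈ (cone-0 A))

  cone-map : ∀ A B (f : Carrierᴹ → Carrierᴹ) → (∀ {u v} → u ≈ᴹ v → f u ≈ᴹ f v) →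
             f 0ᴹ ≈ᴹ 0ᴹ → (∀ x u v → f (x *ₗ u +ᴹ v) ≈ᴹ x *ₗ f u +ᴹ f v) →
             (∀ {a} → A a → Cone B (f a)) → ∀ {v} → Cone A v → Cone B (f v)
  cone-map A B f f-cong f-0 f-linear A⊆ = cone-rec A (λ v → Cone B (f v))
    (λ e → cone-resp B (f-cong e)) (cone-resp B (≈ᴹ-sym f-0) (cone-0 B))
    (λ x≥0 a∈ v∈ → cone-resp B (≈ᴹ-sym (f-linear _ _ _))
      (cone-+ B (cone-*ₗ B x≥0 (A⊆ a∈)) v∈))

  cone-trans : ∀ A B → (∀ {a} → A a → Cone B a) → ∀ {v} → Cone A v → Cone B v
  cone-trans A B = cone-map A B (λ v → v) (λ e → e) ≈ᴹ-refl (λ _ _ _ → ≈ᴹ-refl)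

-- Reflections and the group they generate.

module Reflections {ℝ : RealField} {trig : Trigonometry ℝ} (R : RootSystem ℝ trig) where
  open RealField ℝ
  open RootSystem R
  open OrderedField ℝ public
  open Cones ℝ V public
  open IntegerCoefficients commutativeRing using (Polynomial)
  open import Relation.Binary.Reasoning.Setoid ≈ᴹ-setoid

  -- The pairing of v with the coroot of α.
  ratio : Carrierᴹ → Carrierᴹ → Carrier
  ratio v α = fromℕ 2 * ⟨ v , α ⟩ * ⟨ α , α ⟩ ⁻¹

  ⟨⟩-+ʳ : ∀ u v v′ → ⟨ u , v +ᴹ v′ ⟩ ≈ ⟨ u , v ⟩ + ⟨ u , v′ ⟩
  ⟨⟩-+ʳ u v v′ = trans (⟨⟩-sym _ _) (trans (⟨⟩-+ v v′ u) (+-cong (⟨⟩-sym _ _) (⟨⟩-sym _ _)))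

  ⟨⟩-*ʳ : ∀ x u v → ⟨ u , x *ₗ v ⟩ ≈ x * ⟨ u , v ⟩
  ⟨⟩-*ʳ x u v = trans (⟨⟩-sym _ _) (trans (⟨⟩-* x v u) (*-congˡ (⟨⟩-sym _ _)))

  ⟨⟩-0 : ∀ v → ⟨ 0ᴹ , v ⟩ ≈ 0#
  ⟨⟩-0 v = trans (⟨⟩-cong (≈ᴹ-sym (*ₗ-zeroˡ 0ᴹ)) ≈ᴹ-refl) (trans (⟨⟩-* 0# 0ᴹ v) (zeroˡ _))

  ⟨⟩-neg-*ʳ : ∀ x u v → ⟨ u , -ᴹ (x *ₗ v) ⟩ ≈ - (x * ⟨ u , v ⟩)
  ⟨⟩-neg-*ʳ x u v = trans (⟨⟩-sym _ _) (trans (⟨⟩-neg _ u)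
    (-‿cong (trans (⟨⟩-* x v u) (*-congˡ (⟨⟩-sym _ _)))))

  ⟨s,⟩ : ∀ α u v → ⟨ s α u , v ⟩ ≈ ⟨ u , v ⟩ - ratio u α * ⟨ α , v ⟩
  ⟨s,⟩ α u v = trans (⟨⟩-+ _ _ v)
    (+-congˡ (trans (⟨⟩-neg _ v) (-‿cong (⟨⟩-* _ α v))))

  ratio-+ : ∀ α x u v → ratio (x *ₗ u +ᴹ v) α ≈ x * ratio u α + ratio v α
  ratio-+ α x u v = trans (*-congʳ (*-congˡ (trans (⟨⟩-+ _ v α) (+-congʳ (⟨⟩-* x u α)))))
    (solve 4 (λ x a b i → two :* (x :* a :+ b) :* i := x :* (two :* a :* i) :+ two :* b :* i)
      refl x ⟨ u , α ⟩ ⟨ v , α ⟩ (⟨ α , α ⟩ ⁻¹))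

  ratio-unique : ∀ {α v q} → 0# < ⟨ α , α ⟩ → q * ⟨ α , α ⟩ ≈ fromℕ 2 * ⟨ v , α ⟩ → ratio v α ≈ q
  ratio-unique {α} p e = *-cancelʳ (pos⇒≉0 p) (trans (*-assoc _ _ _)
    (trans (*-congˡ (⁻¹-inverseˡ (pos⇒≉0 p))) (trans (*-identityʳ _) (sym e))))

  -- The ring solver treats `x ⁻¹` as an atom. Identities that depend on inversion are normalised up
  -- to an excess of this shape, which vanishes.
  cancel-⁻¹ : ∀ {x} → 0# < x → ∀ y → y * (x * x ⁻¹) - y ≈ 0#
  cancel-⁻¹ p y = trans (+-congʳ (trans (*-congˡ (⁻¹-inverse (pos⇒≉0 p))) (*-identityʳ y)))
    (-‿inverseʳ y)

  s-linear : ∀ α x u v → s α (x *ₗ u +ᴹ v) ≈ᴹ x *ₗ s α u +ᴹ s α v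
  s-linear α x u v = ≈ᴹ-trans
    (+ᴹ-cong ≈ᴹ-refl (-ᴹ‿cong (*ₗ-cong (ratio-+ α x u v) ≈ᴹ-refl)))
    (proveᴹ (x ∷ ratio u α ∷ ratio v α ∷ []) (α ∷ u ∷ v ∷ [])
      (((X ⊛ U) ⊕ W) ⊕ ⊖ ((X :* A :+ B) ⊛ α′))
      ((X ⊛ (U ⊕ ⊖ (A ⊛ α′))) ⊕ (W ⊕ ⊖ (B ⊛ α′)))
      ≡.refl)
    where
    X A B : Polynomial 3
    X = var zero
    A = var (suc zero)
    B = var (suc (suc zero))
    α′ = # zero
    U = # suc zero
    W = # suc (suc zero)

  s-involutive : ∀ {α} → 0# < ⟨ α , α ⟩ → ∀ v → s α (s α v) ≈ᴹ v
  s-involutive {α} p v = ≈ᴹ-trans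
    (+ᴹ-cong ≈ᴹ-refl (-ᴹ‿cong (*ₗ-cong (ratio-unique p opposite) ≈ᴹ-refl)))
    (proveᴹ (ratio v α ∷ []) (α ∷ v ∷ [])
      ((# suc zero ⊕ ⊖ (var zero ⊛ # zero)) ⊕ ⊖ ((:- var zero) ⊛ # zero)) (# suc zero) ≡.refl)
    where
    opposite : - ratio v α * ⟨ α , α ⟩ ≈ fromℕ 2 * ⟨ s α v , α ⟩
    opposite = trans (solve 3 (λ b i N →
        (:- (two :* b :* i)) :* N :=
        two :* (b :- two :* b :* i :* N) :+ (two :* b :* (N :* i) :- two :* b))
        refl ⟨ v , α ⟩ (⟨ α , α ⟩ ⁻¹) ⟨ α , α ⟩)
      (trans (+-congˡ (cancel-⁻¹ p _)) (trans (+-identityʳ _) (*-congˡ (sym (⟨s,⟩ α v α)))))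

  s-isometry : ∀ {α} → 0# < ⟨ α , α ⟩ → ∀ u v → ⟨ s α u , s α v ⟩ ≈ ⟨ u , v ⟩
  s-isometry {α} p u v = trans (⟨s,⟩ α u (s α v))
    (trans (+-cong (expand u) (-‿cong (*-congˡ (expand α))))
    (trans (+-cong refl (-‿cong (*-congˡ (+-congʳ (⟨⟩-sym α v)))))
    (trans (solve 5 (λ w a b i N →
        (w :- two :* b :* i :* a) :- two :* a :* i :* (b :- two :* b :* i :* N) :=
        w :+ ((two :* two :* a :* b :* i) :* (N :* i) :- two :* two :* a :* b :* i))
        refl ⟨ u , v ⟩ ⟨ u , α ⟩ ⟨ v , α ⟩ (⟨ α , α ⟩ ⁻¹) ⟨ α , α ⟩)
      (trans (+-congˡ (cancel-⁻¹ p _)) (+-identityʳ _)))))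
    where
    expand : ∀ w → ⟨ w , s α v ⟩ ≈ ⟨ w , v ⟩ - ratio v α * ⟨ w , α ⟩
    expand w = trans (⟨⟩-+ʳ w _ _) (+-congˡ (⟨⟩-neg-*ʳ _ w α))

  act-linear : ∀ w x u v → act w (x *ₗ u +ᴹ v) ≈ᴹ x *ₗ act w u +ᴹ act w v
  act-linear []      x u v = ≈ᴹ-refl
  act-linear (i ∷ w) x u v = ≈ᴹ-trans (s-cong (simple i) (act-linear w x u v)) (s-linear _ x _ _)

  act-0 : ∀ w → act w 0ᴹ ≈ᴹ 0ᴹ
  act-0 w = begin
    act w 0ᴹ                              ≈⟨ act-cong w (≈ᴹ-trans (+ᴹ-cong (*ₗ-zeroʳ _) ≈ᴹ-refl) (+ᴹ-identityˡ _)) ⟨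
    act w ((- 1#) *ₗ 0ᴹ +ᴹ 0ᴹ)            ≈⟨ act-linear w (- 1#) 0ᴹ 0ᴹ ⟩
    (- 1#) *ₗ act w 0ᴹ +ᴹ act w 0ᴹ        ≈⟨ +ᴹ-cong (-1*ₗ _) ≈ᴹ-refl ⟩
    -ᴹ act w 0ᴹ +ᴹ act w 0ᴹ               ≈⟨ -ᴹ‿inverseˡ _ ⟩
    0ᴹ                                    ∎

  act-*ₗ : ∀ w x v → act w (x *ₗ v) ≈ᴹ x *ₗ act w v
  act-*ₗ w x v = begin
    act w (x *ₗ v)            ≈⟨ act-cong w (+ᴹ-identityʳ _) ⟨
    act w (x *ₗ v +ᴹ 0ᴹ)      ≈⟨ act-linear w x v 0ᴹ ⟩
    x *ₗ act w v +ᴹ act w 0ᴹ  ≈⟨ +ᴹ-cong ≈ᴹ-refl (act-0 w) ⟩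
    x *ₗ act w v +ᴹ 0ᴹ        ≈⟨ +ᴹ-identityʳ _ ⟩
    x *ₗ act w v              ∎

  act-neg : ∀ w v → act w (-ᴹ v) ≈ᴹ -ᴹ act w v
  act-neg w v = ≈ᴹ-trans (act-cong w (≈ᴹ-sym (-1*ₗ v))) (≈ᴹ-trans (act-*ₗ w _ v) (-1*ₗ _))

  act-++ : ∀ w w′ v → act (w ++ w′) v ≡ act w (act w′ v)
  act-++ []      w′ v = ≡.refl
  act-++ (i ∷ w) w′ v = ≡.cong (s (simple i)) (act-++ w w′ v)

  act-isometry : ∀ w u v → ⟨ act w u , act w v ⟩ ≈ ⟨ u , v ⟩
  act-isometry []      u v = refl
  act-isometry (i ∷ w) u v = trans (s-isometry (simple-pos i) _ _) (act-isometry w u v)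

  act-reverse : ∀ w v → act (reverse w) (act w v) ≈ᴹ v
  act-reverse []      v = ≈ᴹ-refl
  act-reverse (i ∷ w) v = begin
    act (reverse (i ∷ w)) (s (simple i) (act w v))
      ≡⟨ ≡.cong (λ u → act u (s (simple i) (act w v))) (Listₚ.unfold-reverse i w) ⟩
    act (reverse w ++ i ∷ []) (s (simple i) (act w v))
      ≡⟨ act-++ (reverse w) (i ∷ []) _ ⟩
    act (reverse w) (s (simple i) (s (simple i) (act w v)))
      ≈⟨ act-cong (reverse w) (s-involutive (simple-pos i) _) ⟩
    act (reverse w) (act w v)
      ≈⟨ act-reverse w v ⟩
    v ∎

  act-reverseʳ : ∀ w v → act w (act (reverse w) v) ≈ᴹ v
  act-reverseʳ w v = ≡.subst (λ u → act u (act (reverse w) v) ≈ᴹ v)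
    (Listₚ.reverse-involutive w) (act-reverse (reverse w) v)

  -- The form may be indefinite; roots have positive norm because they are images of simple roots
  -- under isometries.
  root-pos : ∀ {v} → Φ v → 0# < ⟨ v , v ⟩
  root-pos (w , i , e) = <-respʳ-≈ (sym (trans (⟨⟩-cong e e) (act-isometry w _ _))) (simple-pos i)

  root-≉0 : ∀ {v} → Φ v → ¬ (v ≈ᴹ 0ᴹ)
  root-≉0 r e = pos⇒≉0 (root-pos r) (trans (⟨⟩-cong e ≈ᴹ-refl) (⟨⟩-0 _))

  Φ-resp : ∀ {u v} → u ≈ᴹ v → Φ u → Φ v
  Φ-resp e (w , i , f) = w , i , ≈ᴹ-trans (≈ᴹ-sym e) f

-- Existence: conical closure is an oriented matroid root system.

module ConeStructure (em : ExcludedMiddle 0ℓ) {ℝ : RealField} {trig : Trigonometry ℝ}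
                     (R : RootSystem ℝ trig) where
  open RealField ℝ
  open RootSystem R
  open Reflections R
  open SubsetOps Rays hiding (Finite)
  open ListSubsets Rays
  open ModuleProperties V using (-ᴹ-involutive)
  open AbelianGroupProperties +ᴹ-abelianGroup using () renaming (ε⁻¹≈ε to -ᴹ0≈0)
  open import Relation.Binary.Reasoning.Setoid ≈ᴹ-setoid

  private
    Rep : Subset Rays → Pred Carrierᴹ 0ℓ
    Rep = Representatives

  ≈ᴹ⇒∼ : ∀ {u v} (p : Φ u) (q : Φ v) → u ≈ᴹ v → (u , p) ∼ (v , q)
  ≈ᴹ⇒∼ p q e = 1# , 0<1 , ≈ᴹ-trans (≈ᴹ-sym e) (≈ᴹ-sym (*ₗ-identityˡ _))

  -- The relation unfolds to a statement about vectors that forgets the proofs of `Φ`, so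
  -- unification cannot recover the endpoints and they are explicit.
  ∼-sym : ∀ x y → x ∼ y → y ∼ x
  ∼-sym x y = Setoid.sym Rays {x} {y}

  ∼-refl : ∀ x → x ∼ x
  ∼-refl x = Setoid.refl Rays {x}

  cone-∼ : ∀ A {x y} → x ∼ y → Cone A (proj₁ x) → Cone A (proj₁ y)
  cone-∼ A (c , p , e) x∈ = cone-resp A (≈ᴹ-sym e) (cone-*ₗ A (inj₁ p) x∈)

  cone-scaled : ∀ A {c} → 0# < c → ∀ {v} → Cone A (c *ₗ v) → Cone A v
  cone-scaled A {c} p {v} v∈ = cone-resp A (begin
    c ⁻¹ *ₗ c *ₗ v      ≈⟨ *ₗ-assoc _ _ _ ⟨
    (c ⁻¹ * c) *ₗ v     ≈⟨ *ₗ-cong (⁻¹-inverseˡ (pos⇒≉0 p)) ≈ᴹ-refl ⟩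
    1# *ₗ v             ≈⟨ *ₗ-identityˡ v ⟩
    v                   ∎)
    (cone-*ₗ A (inj₁ (⁻¹-pos p)) v∈)

  cone-mono : ∀ X Y → X ⊆ Y → ∀ {v} → Cone (Rep X) v → Cone (Rep Y) v
  cone-mono X Y X⊆Y = cone-trans (Rep X) (Rep Y) λ { (p , a∈) → cone-∋ (Rep Y) (p , X⊆Y a∈) }

  coneΦ-∋ : ∀ X x → x ∈ X → x ∈ coneΦ X
  coneΦ-∋ X (v , p) x∈ = cone-∋ (Rep X) (p , x∈)

  positive⇒cone : ∀ x → x ∈ positiveRays → Cone Π (proj₁ x)
  positive⇒cone x (y , (_ , y∈) , x∼y) = cone-∼ Π {y} {x} (∼-sym x y x∼y) y∈

  cone⇒positive : ∀ x → Cone Π (proj₁ x) → x ∈ positiveRays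
  cone⇒positive x@(v , p) x∈ = x , (p , x∈) , ∼-refl x

  coneΦ-isClosureOperator : IsClosureOperator Rays coneΦ
  coneΦ-isClosureOperator = record
    { extensive  = λ X {x} → coneΦ-∋ X x
    ; monotone   = λ {X} {Y} X⊆Y → cone-mono X Y (λ {x} → X⊆Y {x})
    ; idempotent = λ X → cone-trans (Rep (coneΦ X)) (Rep X) proj₂ , λ {x} → coneΦ-∋ (coneΦ X) x
    }

  cone-∪-split : ∀ X y {v} → Cone (Rep (X ∪ ｛ y ｝)) v →
    ∃[ c ] ∃[ w ] 0# ≤ c × Cone (Rep X) w × v ≈ᴹ w +ᴹ c *ₗ proj₁ y
  cone-∪-split X y = cone-rec (Rep (X ∪ ｛ y ｝)) Q
    (λ { e (c , w , c≥0 , w∈ , f) → c , w , c≥0 , w∈ , ≈ᴹ-trans (≈ᴹ-sym e) f })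
    (0# , 0ᴹ , ≤-refl , cone-0 (Rep X) ,
      ≈ᴹ-sym (≈ᴹ-trans (+ᴹ-cong ≈ᴹ-refl (*ₗ-zeroˡ _)) (+ᴹ-identityˡ 0ᴹ)))
    step
    where
    Q : Pred Carrierᴹ 0ℓ
    Q v = ∃[ c ] ∃[ w ] 0# ≤ c × Cone (Rep X) w × v ≈ᴹ w +ᴹ c *ₗ proj₁ y
    step : ∀ {x a v} → 0# ≤ x → Rep (X ∪ ｛ y ｝) a → Q v → Q (x *ₗ a +ᴹ v)
    step {x} {a} {v} x≥0 (p , inj₁ a∈) (c , w , c≥0 , w∈ , f) =
      c , x *ₗ a +ᴹ w , c≥0 , cone-∷ (Rep X) x≥0 (p , a∈) w∈ ,
      ≈ᴹ-trans (+ᴹ-cong ≈ᴹ-refl f) (≈ᴹ-sym (+ᴹ-assoc _ _ _))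
    step {x} {a} {v} x≥0 (p , inj₂ a∼y) (c , w , c≥0 , w∈ , f) with ∼-sym (a , p) y a∼y
    ... | d , d>0 , e = x * d + c , w , +-nonneg (nonneg-* x≥0 (inj₁ d>0)) c≥0 , w∈ ,
      ≈ᴹ-trans (+ᴹ-cong (*ₗ-cong refl e) f)
        (proveᴹ (x ∷ d ∷ c ∷ []) (proj₁ y ∷ w ∷ [])
          ((var zero ⊛ var (suc zero) ⊛ # zero) ⊕ (# suc zero ⊕ (var (suc (suc zero)) ⊛ # zero)))
          (# suc zero ⊕ ((var zero :* var (suc zero) :+ var (suc (suc zero))) ⊛ # zero)) ≡.refl)

  -- The last component records that y can contribute only if it belongs to X; `coneΦ-exchange` uses
  -- it to put a surplus of y back into the cone of X.
  cone-∖-split : ∀ X y {v} → Cone (Rep X) v →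
    ∃[ c ] ∃[ w ] 0# ≤ c × Cone (Rep (X ∖ ｛ y ｝)) w × v ≈ᴹ w +ᴹ c *ₗ proj₁ y × (y ∈ X ⊎ c ≈ 0#)
  cone-∖-split X y {v} v∈ with em {P = y ∈ X}
  ... | yes y∈ =
    let c , w , c≥0 , w∈ , e = cone-∪-split (X ∖ ｛ y ｝) y
          (cone-mono X ((X ∖ ｛ y ｝) ∪ ｛ y ｝) separate v∈)
    in c , w , c≥0 , w∈ , e , inj₁ y∈
    where
    separate : X ⊆ (X ∖ ｛ y ｝) ∪ ｛ y ｝
    separate {z} z∈ with em {P = z ∼ y}
    ... | yes z∼y = inj₂ z∼y
    ... | no  z≁y = inj₁ (z∈ , z≁y)
  ... | no y∉ = 0# , v , ≤-refl ,
    cone-mono X (X ∖ ｛ y ｝)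
      (λ {z} z∈ → z∈ , λ z∼y → y∉ (Subset.resp X {z} {y} z∼y z∈)) v∈ ,
    ≈ᴹ-sym (≈ᴹ-trans (+ᴹ-cong ≈ᴹ-refl (*ₗ-zeroˡ _)) (+ᴹ-identityʳ v)) , inj₂ refl

  -- The relation x = w - c x rearranges to (1 + c) x = w, and 1 + c is positive.
  coneΦ-absorb : ∀ X x → x ∈ coneΦ (X ∪ ｛ negate x ｝) → x ∈ coneΦ X
  coneΦ-absorb X x@(v , _) x∈ with cone-∪-split X (negate x) x∈
  ... | c , w , c≥0 , w∈ , e = cone-scaled (Rep X) {1# + c} (+-pos-nonneg 0<1 c≥0)
    (cone-resp (Rep X) (≈ᴹ-sym (begin
      (1# + c) *ₗ v                        ≈⟨ ≈ᴹ-trans (*ₗ-distribʳ v 1# c) (+ᴹ-cong (*ₗ-identityˡ v) ≈ᴹ-refl) ⟩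
      v +ᴹ c *ₗ v                          ≈⟨ +ᴹ-cong e ≈ᴹ-refl ⟩
      (w +ᴹ c *ₗ (-ᴹ v)) +ᴹ c *ₗ v
        ≈⟨ proveᴹ (c ∷ []) (v ∷ w ∷ [])
             ((# suc zero ⊕ (var zero ⊛ ⊖ # zero)) ⊕ (var zero ⊛ # zero)) (# suc zero) ≡.refl ⟩
      w                                    ∎)) w∈)

  -- Isolating y gives u = w′ + d v - c v. If d < c, solving for v is the claim; otherwise u = w′ +
  -- (d - c) v would already lie in the cone of X.
  coneΦ-exchange : ∀ X x y → x ∈ coneΦ (X ∪ ｛ negate y ｝) → x ∉ coneΦ X →
                   y ∈ coneΦ ((X ∖ ｛ y ｝) ∪ ｛ negate x ｝)
  coneΦ-exchange X x@(u , _) y@(v , q) x∈ x∉ with cone-∪-split X (negate y) x∈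
  ... | c , w , c≥0 , w∈ , e with cone-∖-split X y w∈
  ... | d , w′ , d≥0 , w′∈ , e′ , side with compare d c
  ... | tri< d<c _ _ = cone-scaled (Rep Z) {c - d} (x<y⇒0<y-x d<c)
    (cone-resp (Rep Z) (begin
      w′ +ᴹ -ᴹ u                                        ≈⟨ +ᴹ-cong ≈ᴹ-refl (-ᴹ‿cong relation) ⟩
      w′ +ᴹ -ᴹ ((w′ +ᴹ d *ₗ v) +ᴹ c *ₗ (-ᴹ v))
        ≈⟨ proveᴹ (d ∷ c ∷ []) (v ∷ w′ ∷ [])
             (# suc zero ⊕ ⊖ ((# suc zero ⊕ (var zero ⊛ # zero)) ⊕ (var (suc zero) ⊛ ⊖ # zero)))
             ((var (suc zero) :- var zero) ⊛ # zero) ≡.refl ⟩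
      (c - d) *ₗ v                                      ∎)
      (cone-+ (Rep Z) (cone-mono (X ∖ ｛ y ｝) Z inj₁ w′∈)
        (coneΦ-∋ Z (negate x) (inj₂ (∼-refl (negate x))))))
    where
    Z : Subset Rays
    Z = (X ∖ ｛ y ｝) ∪ ｛ negate x ｝
    relation : u ≈ᴹ (w′ +ᴹ d *ₗ v) +ᴹ c *ₗ (-ᴹ v)
    relation = ≈ᴹ-trans e (+ᴹ-cong e′ ≈ᴹ-refl)
  ... | tri≈ _ d≈c _ = ⊥-elim (x∉ (cone-mono (X ∖ ｛ y ｝) X proj₁
    (cone-resp (Rep (X ∖ ｛ y ｝)) (≈ᴹ-sym (begin
      u                                        ≈⟨ ≈ᴹ-trans e (+ᴹ-cong e′ ≈ᴹ-refl) ⟩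
      (w′ +ᴹ d *ₗ v) +ᴹ c *ₗ (-ᴹ v)            ≈⟨ +ᴹ-cong (+ᴹ-cong ≈ᴹ-refl (*ₗ-cong d≈c ≈ᴹ-refl)) ≈ᴹ-refl ⟩
      (w′ +ᴹ c *ₗ v) +ᴹ c *ₗ (-ᴹ v)
        ≈⟨ proveᴹ (c ∷ []) (v ∷ w′ ∷ [])
             ((# suc zero ⊕ (var zero ⊛ # zero)) ⊕ (var zero ⊛ ⊖ # zero)) (# suc zero) ≡.refl ⟩
      w′                                       ∎)) w′∈)))
  ... | tri> _ _ c<d with side
  ...   | inj₂ d≈0 = ⊥-elim (≤⇒≯ c≥0 (<-respʳ-≈ d≈0 c<d))
  ...   | inj₁ y∈  = ⊥-elim (x∉ (cone-resp (Rep X) (≈ᴹ-sym (begin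
      u                                        ≈⟨ ≈ᴹ-trans e (+ᴹ-cong e′ ≈ᴹ-refl) ⟩
      (w′ +ᴹ d *ₗ v) +ᴹ c *ₗ (-ᴹ v)
        ≈⟨ proveᴹ (d ∷ c ∷ []) (v ∷ w′ ∷ [])
             ((# suc zero ⊕ (var zero ⊛ # zero)) ⊕ (var (suc zero) ⊛ ⊖ # zero))
             (((var zero :- var (suc zero)) ⊛ # zero) ⊕ # suc zero) ≡.refl ⟩
      (d - c) *ₗ v +ᴹ w′                       ∎))
    (cone-∷ (Rep X) (inj₁ (x<y⇒0<y-x c<d)) (q , y∈) (cone-mono (X ∖ ｛ y ｝) X proj₁ w′∈))))

  coneΦ-finitary : ∀ X x → x ∈ coneΦ X → ∃[ Y ] SubsetOps.Finite Rays Y × Y ⊆ X × x ∈ coneΦ Y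
  coneΦ-finitary X x x∈ =
    let xs , xs⊆ , x∈′ = cone-rec (Rep X) Q
          (λ { e (xs , xs⊆ , v∈) → xs , (λ {z} → xs⊆ {z}) , cone-resp (Rep (fromList xs)) e v∈ })
          ([] , (λ ()) , cone-0 (Rep (fromList []))) step x∈
    in fromList xs , (xs , λ z∈ → z∈) , (λ {z} → xs⊆ {z}) , x∈′
    where
    Q : Pred Carrierᴹ 0ℓ
    Q v = Σ[ xs ∈ List Root ] fromList xs ⊆ X × Cone (Rep (fromList xs)) v
    step : ∀ {c a v} → 0# ≤ c → Rep X a → Q v → Q (c *ₗ a +ᴹ v)
    step {c} {a} c≥0 (p , a∈) (xs , xs⊆ , v∈) = (a , p) ∷ xs ,
      (λ { {z} (here e)   → Subset.resp X {(a , p)} {z} (∼-sym z (a , p) e) a∈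
         ; {z} (there z∈) → xs⊆ {z} z∈ }) ,
      cone-∷ (Rep (fromList ((a , p) ∷ xs))) c≥0 (p , here (∼-refl (a , p)))
        (cone-mono (fromList xs) (fromList ((a , p) ∷ xs)) there v∈)

  -- Stated for a linear bijection of the roots with its inverse, so as to cover both negation and
  -- the action of a group element.
  image-coneΦ : (f g : Root → Root) (f̂ ĝ : Carrierᴹ → Carrierᴹ) →
    (∀ x → proj₁ (f x) ≡ f̂ (proj₁ x)) → (∀ x → proj₁ (g x) ≡ ĝ (proj₁ x)) →
    (∀ {u v} → u ≈ᴹ v → f̂ u ≈ᴹ f̂ v) → (∀ {u v} → u ≈ᴹ v → ĝ u ≈ᴹ ĝ v) →
    f̂ 0ᴹ ≈ᴹ 0ᴹ → ĝ 0ᴹ ≈ᴹ 0ᴹ →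
    (∀ c u v → f̂ (c *ₗ u +ᴹ v) ≈ᴹ c *ₗ f̂ u +ᴹ f̂ v) →
    (∀ c u v → ĝ (c *ₗ u +ᴹ v) ≈ᴹ c *ₗ ĝ u +ᴹ ĝ v) →
    (∀ v → f̂ (ĝ v) ≈ᴹ v) → (∀ v → ĝ (f̂ v) ≈ᴹ v) →
    ∀ X → image f (coneΦ X) ≐ coneΦ (image f X)
  image-coneΦ f g f̂ ĝ f≡ g≡ f-cong g-cong f-0 g-0 f-linear g-linear fg gf X =
    (λ { {y} (x , x∈ , y∼fx) → cone-∼ (Rep (image f X)) {f x} {y} (∼-sym y (f x) y∼fx)
         (≡.subst (Cone (Rep (image f X))) (≡.sym (f≡ x))
           (cone-map (Rep X) (Rep (image f X)) f̂ f-cong f-0 f-linear forward x∈)) }) ,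
    (λ { {y@(v , p)} y∈ → g y ,
         ≡.subst (Cone (Rep X)) (≡.sym (g≡ y))
           (cone-map (Rep (image f X)) (Rep X) ĝ g-cong g-0 g-linear backward y∈) ,
         ≈ᴹ⇒∼ p (proj₂ (f (g y)))
           (≡.subst (v ≈ᴹ_) (≡.sym (≡.trans (f≡ (g y)) (≡.cong f̂ (g≡ y)))) (≈ᴹ-sym (fg v))) })
    where
    forward : ∀ {a} → Rep X a → Cone (Rep (image f X)) (f̂ a)
    forward {a} (p , a∈) = ≡.subst (Cone (Rep (image f X))) (f≡ (a , p))
      (coneΦ-∋ (image f X) (f (a , p)) ((a , p) , a∈ , ∼-refl (f (a , p))))
    backward : ∀ {a} → Rep (image f X) a → Cone (Rep X) (ĝ a)
    backward {a} (p , (x@(b , q) , x∈ , a∼fx)) with ∼-sym (a , p) (f x) a∼fx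
    ... | c , c>0 , e = cone-resp (Rep X) (≈ᴹ-sym (begin
      ĝ a                      ≈⟨ g-cong e ⟩
      ĝ (c *ₗ proj₁ (f x))     ≡⟨ ≡.cong (λ w → ĝ (c *ₗ w)) (f≡ x) ⟩
      ĝ (c *ₗ f̂ b)             ≈⟨ g-cong (+ᴹ-identityʳ _) ⟨
      ĝ (c *ₗ f̂ b +ᴹ 0ᴹ)       ≈⟨ g-linear c (f̂ b) 0ᴹ ⟩
      c *ₗ ĝ (f̂ b) +ᴹ ĝ 0ᴹ     ≈⟨ +ᴹ-cong (*ₗ-cong refl (gf b)) g-0 ⟩
      c *ₗ b +ᴹ 0ᴹ             ∎))
      (cone-∷ (Rep X) (inj₁ c>0) (q , x∈) (cone-0 (Rep X)))

  coneΦ-negate : ∀ X → image negate (coneΦ X) ≐ coneΦ (image negate X)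
  coneΦ-negate = image-coneΦ negate negate -ᴹ_ -ᴹ_ (λ _ → ≡.refl) (λ _ → ≡.refl)
    -ᴹ‿cong -ᴹ‿cong -ᴹ0≈0 -ᴹ0≈0 neg-linear neg-linear -ᴹ-involutive -ᴹ-involutive
    where
    neg-linear : ∀ c u v → -ᴹ (c *ₗ u +ᴹ v) ≈ᴹ c *ₗ (-ᴹ u) +ᴹ -ᴹ v
    neg-linear c u v = proveᴹ (c ∷ []) (u ∷ v ∷ [])
      (⊖ ((var zero ⊛ # zero) ⊕ # suc zero)) ((var zero ⊛ ⊖ # zero) ⊕ ⊖ # suc zero) ≡.refl

  coneΦ-equivariant : ∀ X w → coneΦ (image (translate w) X) ≐ image (translate w) (coneΦ X)
  coneΦ-equivariant X w = Product.swap (image-coneΦ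
    (translate w) (translate (reverse w)) (act w) (act (reverse w))
    (λ _ → ≡.refl) (λ _ → ≡.refl) (act-cong w) (act-cong (reverse w))
    (act-0 w) (act-0 (reverse w)) (act-linear w) (act-linear (reverse w))
    (act-reverseʳ w) (act-reverse w) X)

  coneΦ-singleton : ∀ x → coneΦ ｛ x ｝ ≐ ｛ x ｝
  coneΦ-singleton x = (λ {y} → multiple y) , λ {y} → coneΦ-∋ ｛ x ｝ y
    where
    multiple : ∀ y → y ∈ coneΦ ｛ x ｝ → y ∼ x
    -- The singleton is read as a union with ∅, so the remainder w of the split is a combination of
    -- nothing and vanishes.
    multiple y@(v , p) y∈ with cone-∪-split ∅ x (cone-mono ｛ x ｝ (∅ ∪ ｛ x ｝) inj₂ y∈)
    ... | c , w , c≥0 , w∈ , e = ∼-sym x y (c , positive c≥0 , e′)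
      where
      w≈0 : w ≈ᴹ 0ᴹ
      w≈0 = cone-rec (Rep ∅) (_≈ᴹ 0ᴹ) (λ e f → ≈ᴹ-trans (≈ᴹ-sym e) f) ≈ᴹ-refl (λ { _ (_ , ()) _ }) w∈
      e′ : v ≈ᴹ c *ₗ proj₁ x
      e′ = ≈ᴹ-trans e (≈ᴹ-trans (+ᴹ-cong w≈0 ≈ᴹ-refl) (+ᴹ-identityˡ _))
      positive : 0# ≤ c → 0# < c
      positive (inj₁ c>0) = c>0
      positive (inj₂ c≈0) = ⊥-elim (root-≉0 p
        (≈ᴹ-trans e′ (≈ᴹ-trans (*ₗ-cong (sym c≈0) ≈ᴹ-refl) (*ₗ-zeroˡ _))))

  coneΦ-∅ : ∀ x → x ∉ coneΦ ∅
  coneΦ-∅ (v , p) x∈ = root-≉0 p (cone-rec (Rep ∅) (_≈ᴹ 0ᴹ)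
    (λ e f → ≈ᴹ-trans (≈ᴹ-sym e) f) ≈ᴹ-refl (λ { _ (_ , ()) _ }) x∈)

  -- From v = - c v with c > 0 it would follow that (1 + c) ⟨ v , v ⟩ = 0, although both factors are
  -- positive.
  negate-≁ : ∀ x → ¬ (negate x ∼ x)
  negate-≁ (v , p) (c , c>0 , e) = pos⇒≉0 (*-pos (+-pos-nonneg 0<1 (inj₁ c>0)) (root-pos p)) (trans
    (sym (⟨⟩-* (1# + c) v v)) (trans (⟨⟩-cong (begin
      (1# + c) *ₗ v           ≈⟨ ≈ᴹ-trans (*ₗ-distribʳ v 1# c) (+ᴹ-cong (*ₗ-identityˡ v) ≈ᴹ-refl) ⟩
      v +ᴹ c *ₗ v             ≈⟨ +ᴹ-cong e ≈ᴹ-refl ⟩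
      c *ₗ (-ᴹ v) +ᴹ c *ₗ v
        ≈⟨ proveᴹ (c ∷ []) (v ∷ []) ((var zero ⊛ ⊖ # zero) ⊕ (var zero ⊛ # zero)) 𝟎 ≡.refl ⟩
      0ᴹ                      ∎) ≈ᴹ-refl) (⟨⟩-0 v)))

  negate-cong : ∀ x y → x ∼ y → negate x ∼ negate y
  negate-cong (u , _) (v , _) (c , c>0 , e) = c , c>0 , ≈ᴹ-trans (-ᴹ‿cong e)
    (proveᴹ (c ∷ []) (u ∷ []) (⊖ (var zero ⊛ # zero)) (var zero ⊛ ⊖ # zero) ≡.refl)

  negate-involutive : ∀ x → negate (negate x) ∼ x
  negate-involutive x@(_ , p) = ≈ᴹ⇒∼ (proj₂ (negate (negate x))) p (-ᴹ-involutive _)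

  coneΦ-isOMRS : IsOMRS coneΦ
  coneΦ-isOMRS = record
    { isOrientedMatroid = record
        { *-cong            = λ {x} {y} → negate-cong x y
        ; *-involutive      = negate-involutive
        ; *-fixedPointFree  = negate-≁
        ; isClosureOperator = coneΦ-isClosureOperator
        ; cx-*              = coneΦ-negate
        ; cx-absorb         = coneΦ-absorb
        ; cx-exchange       = coneΦ-exchange
        ; cx-finitary       = coneΦ-finitary
        }
    ; isReduced = record
        { cx-∅         = (λ {x} x∈ → ⊥-elim (coneΦ-∅ x x∈)) , λ ()
        ; cx-singleton = coneΦ-singleton
        }
    ; equivariant     = coneΦ-equivariant
    ; positive-closed =
        (λ {x} x∈ → cone⇒positive x (cone-trans (Rep positiveRays) Π
          (λ { {a} (p , a∈) → positive⇒cone (a , p) a∈ }) x∈)) ,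
        λ {x} → coneΦ-∋ positiveRays x
    ; rank-two        = λ _ _ → (λ x∈ → x∈) , (λ x∈ → x∈)
    }

-- Chebyshev polynomials, sine and cosine.

module Chebyshev (ℝ : RealField) where
  open RealField ℝ
  open OrderedField ℝ

  -- Chebyshev polynomials of the second kind at c/2, shifted so that
  -- U (2 cos θ) k sin θ = sin (k θ).
  U : Carrier → ℕ → Carrier
  U c 0             = 0#
  U c 1             = 1#
  U c (suc (suc k)) = c * U c (suc k) - U c k

  -- The induction carries the increments along: each is the previous one plus (c - 2) times a
  -- nonnegative value. This is the case of an infinite dihedral group.
  U-nonneg : ∀ {c} → fromℕ 2 ≤ c → ∀ k → 0# ≤ U c k
  U-nonneg {c} 2≤c k = proj₁ (go k)
    where
    go : ∀ k → 0# ≤ U c k × 0# ≤ U c (suc k) - U c k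
    go zero    = ≤-refl , x≤y⇒0≤y-x 0≤1
    go (suc k) with go k
    ... | p , q = p′ , ≤-respʳ-≈
        (solve 3 (λ c x y → (c :- two) :* x :+ (x :- y) := (c :* x :- y) :- x) refl c _ _)
        (+-nonneg (nonneg-* (x≤y⇒0≤y-x 2≤c) p′) q)
      where
      p′ : 0# ≤ U c (suc k)
      p′ = ≤-respʳ-≈ (solve 2 (λ x y → x :+ (y :- x) := y) refl _ _) (+-nonneg p q)

  fromℕ-nonneg : ∀ k → 0# ≤ fromℕ k
  fromℕ-nonneg zero    = ≤-refl
  fromℕ-nonneg (suc k) = +-nonneg 0≤1 (fromℕ-nonneg k)

  fromℕ-pos : ∀ k → 0# < fromℕ (suc k)
  fromℕ-pos k = +-pos-nonneg 0<1 (fromℕ-nonneg k)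

  fromℕ-mono : ∀ {j k} → j ℕ.≤ k → fromℕ j ≤ fromℕ k
  fromℕ-mono (ℕ.z≤n {k}) = fromℕ-nonneg k
  fromℕ-mono (ℕ.s≤s p)   = 0≤y-x⇒x≤y (≤-respʳ-≈
    -- `1#` enters as an atom, because the literal 1 would evaluate to `1# + 0#`.
    (solve 3 (λ u x y → y :- x := (u :+ y) :- (u :+ x)) refl 1# _ _) (x≤y⇒0≤y-x (fromℕ-mono p)))

  *-monoˡ-≤ : ∀ {x y z} → 0# ≤ z → x ≤ y → x * z ≤ y * z
  *-monoˡ-≤ z≥0 x≤y = 0≤y-x⇒x≤y (≤-respʳ-≈
    (solve 3 (λ x y z → (y :- x) :* z := y :* z :- x :* z) refl _ _ _)
    (nonneg-* (x≤y⇒0≤y-x x≤y) z≥0))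

module TrigonometryLemmas {ℝ : RealField} (trig : Trigonometry ℝ) where
  open RealField ℝ
  open Trigonometry trig
  open OrderedField ℝ
  open Chebyshev ℝ
  open RingProperties ring using (-‿involutive; -1*x≈-x)
  open import Relation.Binary.Reasoning.Setoid setoid

  2≉0 : ¬ (fromℕ 2 ≈ 0#)
  2≉0 = pos⇒≉0 (fromℕ-pos 1)

  π/2+π/2 : π/2 + π/2 ≈ π
  π/2+π/2 = trans (solve 2 (λ p i → p :* i :+ p :* i := p :* (two :* i)) refl π (fromℕ 2 ⁻¹))
    (trans (*-congˡ (⁻¹-inverse 2≉0)) (*-identityʳ π))

  cos²+sin² : ∀ x → cos x * cos x + sin x * sin x ≈ 1#
  cos²+sin² x = trans (sym (cos-diff x x)) (trans (cos-cong (-‿inverseʳ x)) cos-0)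

  unit-circle : ∀ {x y} → x * x + y * y ≈ 1# → x * x ≈ 1# → y ≈ 0#
  unit-circle {x} {y} e f = square≈0 (begin
    y * y                      ≈⟨ solve 2 (λ a b → b := (a :+ b) :- a) refl (x * x) (y * y) ⟩
    (x * x + y * y) - x * x    ≈⟨ +-cong e (-‿cong f) ⟩
    1# - 1#                    ≈⟨ -‿inverseʳ 1# ⟩
    0#                         ∎)

  cos-π/2 : cos π/2 ≈ 0#
  cos-π/2 = unit-circle (trans (+-comm _ _) (cos²+sin² π/2))
    (trans (*-cong sin-π/2 sin-π/2) (*-identityˡ 1#))

  sin-π : sin π ≈ 0#
  sin-π = unit-circle (cos²+sin² π) (trans (*-cong cos-π cos-π)
    (trans (-1*x≈-x (- 1#)) (-‿involutive 1#)))

  sin-0 : sin 0# ≈ 0#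
  sin-0 = unit-circle (cos²+sin² 0#) (trans (*-cong cos-0 cos-0) (*-identityˡ 1#))

  -- The axioms have `cos-diff` as their only addition formula. Formulas for the sine are obtained
  -- by writing it as a shifted cosine, and the opposite shift is computed separately since parity
  -- of the functions is not an axiom.
  cos-π/2- : ∀ x → cos (π/2 - x) ≈ sin x
  cos-π/2- x = begin
    cos (π/2 - x)                       ≈⟨ cos-diff x π/2 ⟩
    cos π/2 * cos x + sin π/2 * sin x   ≈⟨ +-cong (*-congʳ cos-π/2) (*-congʳ sin-π/2) ⟩
    0# * cos x + 1# * sin x             ≈⟨ +-cong (zeroˡ _) (*-identityˡ _) ⟩
    0# + sin x                          ≈⟨ +-identityˡ _ ⟩
    sin x                               ∎

  sin-π/2- : ∀ x → sin (π/2 - x) ≈ cos x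
  sin-π/2- x = trans (sym (cos-π/2- (π/2 - x)))
    (cos-cong (solve 2 (λ p x → p :- (p :- x) := x) refl π/2 x))

  cos-π- : ∀ x → cos (π - x) ≈ - cos x
  cos-π- x = begin
    cos (π - x)                     ≈⟨ cos-diff x π ⟩
    cos π * cos x + sin π * sin x   ≈⟨ +-cong (*-congʳ cos-π) (*-congʳ sin-π) ⟩
    - 1# * cos x + 0# * sin x       ≈⟨ +-cong (-1*x≈-x _) (zeroˡ _) ⟩
    - cos x + 0#                    ≈⟨ +-identityʳ _ ⟩
    - cos x                         ∎

  cos-‿π/2 : ∀ x → cos (x - π/2) ≈ sin x
  cos-‿π/2 x = begin
    cos (x - π/2)                       ≈⟨ cos-diff π/2 x ⟩
    cos x * cos π/2 + sin x * sin π/2   ≈⟨ +-cong (*-congˡ cos-π/2) (*-congˡ sin-π/2) ⟩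
    cos x * 0# + sin x * 1#             ≈⟨ +-cong (zeroʳ _) (*-identityʳ _) ⟩
    0# + sin x                          ≈⟨ +-identityˡ _ ⟩
    sin x                               ∎

  sin-‿π/2 : ∀ x → sin (x - π/2) ≈ - cos x
  sin-‿π/2 x = begin
    sin (x - π/2)          ≈⟨ cos-π/2- (x - π/2) ⟨
    cos (π/2 - (x - π/2))  ≈⟨ cos-cong (solve 2 (λ p x → p :- (x :- p) := (p :+ p) :- x) refl π/2 x) ⟩
    cos (π/2 + π/2 - x)    ≈⟨ cos-cong (+-congʳ π/2+π/2) ⟩
    cos (π - x)            ≈⟨ cos-π- x ⟩
    - cos x                ∎

  sin-π- : ∀ x → sin (π - x) ≈ sin x
  sin-π- x = begin
    sin (π - x)            ≈⟨ cos-π/2- (π - x) ⟨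
    cos (π/2 - (π - x))    ≈⟨ cos-cong (+-congˡ (-‿cong (+-congʳ π/2+π/2))) ⟨
    cos (π/2 - (π/2 + π/2 - x))
                           ≈⟨ cos-cong (solve 2 (λ p x → p :- ((p :+ p) :- x) := x :- p) refl π/2 x) ⟩
    cos (x - π/2)          ≈⟨ cos-‿π/2 x ⟩
    sin x                  ∎

  sin-+ : ∀ x h → sin (x + h) ≈ sin x * cos h + cos x * sin h
  sin-+ x h = begin
    sin (x + h)              ≈⟨ cos-π/2- (x + h) ⟨
    cos (π/2 - (x + h))      ≈⟨ cos-cong (solve 3 (λ p x h → p :- (x :+ h) := (p :- x) :- h) refl π/2 x h) ⟩
    cos ((π/2 - x) - h)      ≈⟨ cos-diff h (π/2 - x) ⟩
    cos (π/2 - x) * cos h + sin (π/2 - x) * sin h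
                             ≈⟨ +-cong (*-congʳ (cos-π/2- x)) (*-congʳ (sin-π/2- x)) ⟩
    sin x * cos h + cos x * sin h ∎

  sin-diff : ∀ x h → sin (x - h) ≈ sin x * cos h - cos x * sin h
  sin-diff x h = begin
    sin (x - h)              ≈⟨ cos-π/2- (x - h) ⟨
    cos (π/2 - (x - h))      ≈⟨ cos-cong (solve 3 (λ p x h → p :- (x :- h) := h :- (x :- p)) refl π/2 x h) ⟩
    cos (h - (x - π/2))      ≈⟨ cos-diff (x - π/2) h ⟩
    cos h * cos (x - π/2) + sin h * sin (x - π/2)
                             ≈⟨ +-cong (*-congˡ (cos-‿π/2 x)) (*-congˡ (sin-‿π/2 x)) ⟩
    cos h * sin x + sin h * - cos x
                             ≈⟨ solve 4 (λ s c s′ c′ → c′ :* s :+ s′ :* (:- c) := s :* c′ :- c :* s′)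
                                  refl (sin x) (cos x) (sin h) (cos h) ⟩
    sin x * cos h - cos x * sin h ∎

  -- `bounds` makes the cosine positive between 0 and π/2, and x ↦ π/2 - x carries this to the sine;
  -- the endpoint is the axiom `sin-π/2`.
  sin-pos : ∀ {x} → 0# < x → x ≤ π/2 → 0# < sin x
  sin-pos {x} 0<x (inj₁ x<π/2) = <-respʳ-≈ (cos-π/2- x) (proj₁ (bounds (x<y⇒0<y-x x<π/2)
    (0<y-x⇒x<y (<-respʳ-≈ (solve 2 (λ p x → x := p :- (p :- x)) refl π/2 x) 0<x))))
  sin-pos 0<x (inj₂ x≈π/2) = <-respʳ-≈ (sym (trans (sin-cong x≈π/2) sin-π/2)) 0<1

  sin-nonneg-π/2 : ∀ {x} → 0# ≤ x → x ≤ π/2 → 0# ≤ sin x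
  sin-nonneg-π/2 (inj₁ 0<x) x≤ = inj₁ (sin-pos 0<x x≤)
  sin-nonneg-π/2 (inj₂ 0≈x) _  = inj₂ (sym (trans (sin-cong (sym 0≈x)) sin-0))

  sin-nonneg : ∀ {x} → 0# ≤ x → x ≤ π → 0# ≤ sin x
  sin-nonneg {x} 0≤x x≤π with ≤-total x π/2
  ... | inj₁ x≤π/2 = sin-nonneg-π/2 0≤x x≤π/2
  ... | inj₂ π/2≤x = ≤-respʳ-≈ (sin-π- x) (sin-nonneg-π/2 (x≤y⇒0≤y-x x≤π)
    (0≤y-x⇒x≤y (≤-respʳ-≈ (trans
      (solve 2 (λ p x → x :- p := p :- ((p :+ p) :- x)) refl π/2 x)
      (+-congˡ (-‿cong (+-congʳ π/2+π/2)))) (x≤y⇒0≤y-x π/2≤x))))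

  -- With x = (k + 1) θ, the sum of sin (x + θ) and sin (x - θ) is 2 cos θ sin x, which is the
  -- recurrence of `U`.
  U-sin : ∀ θ k → U (fromℕ 2 * cos θ) k * sin θ ≈ sin (fromℕ k * θ)
  U-sin θ 0 = trans (zeroˡ _) (sym (trans (sin-cong (zeroˡ θ)) sin-0))
  U-sin θ 1 = trans (*-identityˡ _) (sym (sin-cong
    (trans (*-congʳ (+-identityʳ 1#)) (*-identityˡ θ))))
  U-sin θ (suc (suc k)) = begin
    (fromℕ 2 * cos θ * U _ (suc k) - U _ k) * sin θ
      ≈⟨ solve 4 (λ c u v z → (two :* c :* u :- v) :* z := two :* c :* (u :* z) :- v :* z)
           refl (cos θ) (U _ (suc k)) (U _ k) (sin θ) ⟩
    fromℕ 2 * cos θ * (U _ (suc k) * sin θ) - U _ k * sin θ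
      ≈⟨ +-cong (*-congˡ (U-sin θ (suc k))) (-‿cong (U-sin θ k)) ⟩
    fromℕ 2 * cos θ * sin x - sin (fromℕ k * θ)
      ≈⟨ +-congˡ (-‿cong (trans (sin-cong (backward (fromℕ k))) (sin-diff x θ))) ⟩
    fromℕ 2 * cos θ * sin x - (sin x * cos θ - cos x * sin θ)
      ≈⟨ solve 4 (λ s c s′ c′ → two :* c′ :* s :- (s :* c′ :- c :* s′) := s :* c′ :+ c :* s′)
           refl (sin x) (cos x) (sin θ) (cos θ) ⟩
    sin x * cos θ + cos x * sin θ
      ≈⟨ trans (sin-cong (forward (fromℕ (suc k)))) (sin-+ x θ) ⟨
    sin (fromℕ (suc (suc k)) * θ) ∎
    where
    x : Carrier
    x = fromℕ (suc k) * θ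
    forward : ∀ y → (1# + y) * θ ≈ y * θ + θ
    forward y = trans (distribʳ θ 1# y) (trans (+-comm _ _) (+-congˡ (*-identityˡ θ)))
    backward : ∀ y → y * θ ≈ (1# + y) * θ - θ
    backward y = trans (solve 2 (λ a t → a := a :+ t :- t) refl (y * θ) θ) (+-congʳ (sym (forward y)))

  module _ (m : ℕ) where

    -- The index is shifted by 2, so that the denominator is at least 2 as in the definition of an
    -- admissible cosine.
    θ : Carrier
    θ = π * fromℕ (suc (suc m)) ⁻¹

    private
      n : ℕ
      n = suc (suc m)
      c : Carrier
      c = fromℕ 2 * cos θ

    nθ≈π : fromℕ n * θ ≈ π
    nθ≈π = trans (solve 3 (λ k p i → k :* (p :* i) := p :* (k :* i)) refl (fromℕ n) π (fromℕ n ⁻¹))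
      (trans (*-congˡ (⁻¹-inverse (pos⇒≉0 (fromℕ-pos (suc m))))) (*-identityʳ π))

    0<θ : 0# < θ
    0<θ = *-pos 0<π (⁻¹-pos (fromℕ-pos (suc m)))

    kθ≤π : ∀ {k} → k ℕ.≤ n → fromℕ k * θ ≤ π
    kθ≤π p = ≤-respʳ-≈ nθ≈π (*-monoˡ-≤ (inj₁ 0<θ) (fromℕ-mono p))

    θ≤π/2 : θ ≤ π/2
    θ≤π/2 = ≤-respˡ-≈
      (trans (solve 2 (λ t i → two :* t :* i := t :* (two :* i)) refl θ (fromℕ 2 ⁻¹))
        (trans (*-congˡ (⁻¹-inverse 2≉0)) (*-identityʳ θ)))
      (*-monoˡ-≤ (inj₁ (⁻¹-pos (fromℕ-pos 1))) (kθ≤π (ℕ.s≤s (ℕ.s≤s ℕ.z≤n))))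

    sinθ>0 : 0# < sin θ
    sinθ>0 = sin-pos 0<θ θ≤π/2

    cosθ≥0 : 0# ≤ cos θ
    cosθ≥0 = ≤-respʳ-≈ (sin-π/2- θ) (sin-nonneg-π/2 (x≤y⇒0≤y-x θ≤π/2)
      (0≤y-x⇒x≤y (≤-respʳ-≈ (solve 2 (λ p x → x := p :- (p :- x)) refl π/2 θ) (inj₁ 0<θ))))

    U-nonneg-≤ : ∀ {k} → k ℕ.≤ n → 0# ≤ U c k
    U-nonneg-≤ {k} p = *-pos-cancel sinθ>0 (≤-respʳ-≈ (sym (U-sin θ k))
      (sin-nonneg (nonneg-* (fromℕ-nonneg k) (inj₁ 0<θ)) (kθ≤π p)))

    U-n : U c n ≈ 0#
    U-n = *-cancelʳ (pos⇒≉0 sinθ>0) (trans (U-sin θ n)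
      (trans (sin-cong nθ≈π) (trans sin-π (sym (zeroˡ _)))))

    -- Since sin (π - θ) = sin θ. Together with `U-n` it says that an alternating word of length n -
    -- 1 carries a simple root to the ray of a simple root, the source of the braid relation.
    U-pred-n : U c (suc m) ≈ 1#
    U-pred-n = *-cancelʳ (pos⇒≉0 sinθ>0) (trans (U-sin θ (suc m))
      (trans (sin-cong (trans (solve 3 (λ u k t → k :* t := (u :+ k) :* t :- u :* t) refl 1# (fromℕ (suc m)) θ)
        (+-cong nθ≈π (-‿cong (*-identityˡ θ)))))
      (trans (sin-π- θ) (sym (*-identityˡ _)))))

-- Reduced words and dihedral subgroups.

module Words (em : ExcludedMiddle 0ℓ) {ℝ : RealField} {trig : Trigonometry ℝ}
             (R : RootSystem ℝ trig) where
  open RealField ℝ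
  open Trigonometry trig using (cos)
  open RootSystem R
  open Reflections R
  open Chebyshev ℝ
  open TrigonometryLemmas trig using (U-nonneg-≤; U-n; U-pred-n; cosθ≥0)
  open RingProperties ring using (-‿involutive)
  open import Relation.Binary.Reasoning.Setoid ≈ᴹ-setoid

  infix 4 _≋_

  -- Tracking the parity makes lengths of words with equal action
  -- comparable without a presentation of the group.
  record _≋_ (x y : Word) : Set where
    constructor _,_
    field
      same-action : ∀ v → act x v ≈ᴹ act y v
      same-parity : parity (length x) ≡ parity (length y)

  open _≋_

  ≋-refl : ∀ {x} → x ≋ x
  ≋-refl = (λ _ → ≈ᴹ-refl) , ≡.refl

  ≋-reflexive : ∀ {x y} → x ≡ y → x ≋ y
  ≋-reflexive ≡.refl = ≋-refl

  ≋-sym : ∀ {x y} → x ≋ y → y ≋ x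
  ≋-sym (f , p) = (λ v → ≈ᴹ-sym (f v)) , ≡.sym p

  ≋-trans : ∀ {x y z} → x ≋ y → y ≋ z → x ≋ z
  ≋-trans (f , p) (g , q) = (λ v → ≈ᴹ-trans (f v) (g v)) , ≡.trans p q

  parity-++ : ∀ (x y : Word) → parity (length (x ++ y)) ≡ parity (length x) ℙ.+ parity (length y)
  parity-++ x y = ≡.trans (≡.cong parity (Listₚ.length-++ x)) (ℙₚ.+-homo-+ (length x) (length y))

  ≋-++ : ∀ {x x′ y y′} → x ≋ x′ → y ≋ y′ → x ++ y ≋ x′ ++ y′
  ≋-++ {x} {x′} {y} {y′} (f , p) (g , q) =
    (λ v → begin
      act (x ++ y) v      ≡⟨ act-++ x y v ⟩
      act x (act y v)     ≈⟨ act-cong x (g v) ⟩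
      act x (act y′ v)    ≈⟨ f _ ⟩
      act x′ (act y′ v)   ≡⟨ act-++ x′ y′ v ⟨
      act (x′ ++ y′) v    ∎) ,
    ≡.trans (parity-++ x y) (≡.trans (≡.cong₂ ℙ._+_ p q) (≡.sym (parity-++ x′ y′)))

  ≋-double : ∀ x i y → x ++ i ∷ i ∷ y ≋ x ++ y
  ≋-double x i y = ≋-++ {x} ≋-refl ((λ v → s-involutive (simple-pos i) (act y v)) , ≡.refl)

  record Reduced (w : Word) : Set where
    constructor reduced
    field
      minimal : ∀ {w′} → w′ ≋ w → length w ℕ.≤ length w′

  open Reduced

  reduced-resp : ∀ {x y} → x ≋ y → length x ℕ.≤ length y → Reduced y → Reduced x
  reduced-resp x≋y p red = reduced λ w≋x → ℕₚ.≤-trans p (minimal red (≋-trans w≋x x≋y))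

  reduced-prefix : ∀ x y → Reduced (x ++ y) → Reduced x
  reduced-prefix x y red = reduced λ {w} w≋x → ℕₚ.+-cancelʳ-≤ (length y) (length x) (length w)
    (≡.subst₂ ℕ._≤_ (Listₚ.length-++ x) (Listₚ.length-++ w) (minimal red (≋-++ w≋x (≋-refl {y}))))

  reduced-suffix : ∀ x y → Reduced (x ++ y) → Reduced y
  reduced-suffix x y red = reduced λ {w} w≋y → ℕₚ.+-cancelˡ-≤ (length x) (length y) (length w)
    (≡.subst₂ ℕ._≤_ (Listₚ.length-++ x) (Listₚ.length-++ x) (minimal red (≋-++ (≋-refl {x}) w≋y)))

  reduced-or-shorter : ∀ w → Reduced w ⊎ ∃[ w′ ] w′ ≋ w × length w′ ℕ.< length w
  reduced-or-shorter w with em {P = ∃[ w′ ] w′ ≋ w × length w′ ℕ.< length w}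
  ... | yes shorter = inj₂ shorter
  ... | no  none    = inj₁ (reduced λ {w′} w′≋w → ℕₚ.≮⇒≥ (λ p → none (w′ , w′≋w , p)))

  reduced-form : ∀ w → ∃[ w′ ] w′ ≋ w × Reduced w′
  reduced-form w = go (suc (length w)) w ℕₚ.≤-refl
    where
    go : ∀ k w → length w ℕ.< k → ∃[ w′ ] w′ ≋ w × Reduced w′
    go (suc k) w (ℕ.s≤s p) with reduced-or-shorter w
    ... | inj₁ red = w , ≋-refl , red
    ... | inj₂ (x , x≋w , x<w) =
      let y , y≋x , red = go k x (ℕₚ.<-≤-trans x<w p) in y , ≋-trans y≋x x≋w , red

  length-∷ʳ : ∀ (w : Word) (i : Fin n) → length (w ++ i ∷ []) ≡ suc (length w)
  length-∷ʳ w i = ≡.trans (Listₚ.length-++ w) (ℕₚ.+-comm (length w) 1)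

  -- Equal length with w is excluded by parity. This replaces the fact that right multiplication by
  -- a simple reflection changes the length by exactly one.
  shorter-by-two : ∀ {x} w i → x ≋ w ++ i ∷ [] → length x ℕ.< length (w ++ i ∷ []) →
                   length x ℕ.< length w
  shorter-by-two {x} w i (_ , p) x<wi = ℕₚ.≤∧≢⇒<
    (ℕₚ.≤-pred (≡.subst (length x ℕ.<_) (length-∷ʳ w i) x<wi))
    λ eq → ℙₚ.p≢p⁻¹ (parity (length w)) (≡.trans (≡.cong parity (≡.sym eq))
      (≡.trans p (≡.trans (≡.cong parity (length-∷ʳ w i)) (parity-suc (length w)))))
    where
    parity-suc : ∀ k → parity (suc k) ≡ parity k ℙ.⁻¹
    parity-suc k = ≡.trans (≡.sym (ℙₚ.⁻¹-involutive _)) (≡.cong ℙ._⁻¹ (ℙₚ.suc-homo-⁻¹ k))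

  -- w s_α = s_{wα} w, for a root wα on the ray of a simple root.
  conjugate : ∀ w {i j x} → 0# < x → act w (simple i) ≈ᴹ x *ₗ simple j → j ∷ w ++ i ∷ [] ≋ w
  conjugate w {i} {j} {x} x>0 e = action ,
    ≡.cong (parity ∘ suc) (length-∷ʳ w i)
    where
    action : ∀ v → act (j ∷ w ++ i ∷ []) v ≈ᴹ act w v
    action v = begin
      s α (act (w ++ i ∷ []) v)                     ≡⟨ ≡.cong (s α) (act-++ w (i ∷ []) v) ⟩
      s α (act w (v +ᴹ -ᴹ (q *ₗ simple i)))         ≈⟨ s-cong α (act-cong w (shuffle v (simple i))) ⟩
      s α (act w ((- q) *ₗ simple i +ᴹ v))          ≈⟨ s-cong α (act-linear w (- q) _ v) ⟩
      s α ((- q) *ₗ act w (simple i) +ᴹ act w v)    ≈⟨ s-linear α (- q) _ _ ⟩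
      (- q) *ₗ s α (act w (simple i)) +ᴹ s α (act w v)
        ≈⟨ +ᴹ-cong (*ₗ-cong refl (≈ᴹ-trans (s-cong α e) (≈ᴹ-trans (act-*ₗ (j ∷ []) x α)
             (*ₗ-cong refl (s-self α (simple-pos j))))))
             (+ᴹ-cong ≈ᴹ-refl (-ᴹ‿cong (*ₗ-cong ratio-w ≈ᴹ-refl))) ⟩
      (- q) *ₗ x *ₗ (-ᴹ α) +ᴹ (act w v +ᴹ -ᴹ ((q * x) *ₗ α))
        ≈⟨ proveᴹ (q ∷ x ∷ []) (α ∷ act w v ∷ [])
             (((:- var zero) ⊛ var (suc zero) ⊛ ⊖ # zero) ⊕
               (# suc zero ⊕ ⊖ ((var zero :* var (suc zero)) ⊛ # zero)))
             (# suc zero) ≡.refl ⟩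
      act w v                                       ∎
      where
      α : Carrierᴹ
      α = simple j
      q : Carrier
      q = ratio v (simple i)
      shuffle : ∀ v β → v +ᴹ -ᴹ (q *ₗ β) ≈ᴹ (- q) *ₗ β +ᴹ v
      shuffle v β = proveᴹ (q ∷ []) (β ∷ v ∷ []) (# suc zero ⊕ ⊖ (var zero ⊛ # zero))
        (((:- var zero) ⊛ # zero) ⊕ # suc zero) ≡.refl
      -- By isometry x² ⟨ α , α ⟩ is the norm of `simple i`, and x ⟨ act w v , α ⟩ is its product
      -- with v.
      ratio-w : ratio (act w v) α ≈ q * x
      ratio-w = ratio-unique (simple-pos j) (*-cancelʳ (pos⇒≉0 x>0) (trans
        (solve 3 (λ q x a → q :* x :* a :* x := q :* (x :* (x :* a))) refl q x ⟨ α , α ⟩)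
        (trans (*-congˡ (trans (sym (trans (⟨⟩-* x α _) (*-congˡ (⟨⟩-*ʳ x α α))))
          (trans (sym (⟨⟩-cong e e)) (act-isometry w _ _))))
        (trans (trans (*-assoc _ _ _) (trans (*-congˡ (⁻¹-inverseˡ (pos⇒≉0 (simple-pos i)))) (*-identityʳ _)))
        (trans (*-congˡ (trans (sym (act-isometry w v (simple i)))
          (trans (⟨⟩-cong ≈ᴹ-refl e) (⟨⟩-*ʳ x (act w v) α))))
        (solve 2 (λ x b → two :* (x :* b) := two :* b :* x) refl x ⟨ act w v , α ⟩))))))

  -- Signs of the root coefficients in a dihedral group: infinite in the first alternative, with
  -- rotation of order p + 1 in the second.
  Bounded : Carrier → Set
  Bounded c = (∀ k → 0# ≤ U c k) ⊎
    ∃[ p ] (∀ {k} → k ℕ.≤ suc p → 0# ≤ U c k) × U c (suc p) ≈ 0# × U c p ≈ 1#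

  admissible : ∀ {x} → AdmissibleCosine x → ∃[ c ] 0# ≤ c × fromℕ 2 * x ≈ - c × Bounded c
  admissible (inj₁ (suc (suc m) , ℕ.s≤s (ℕ.s≤s ℕ.z≤n) , x≈)) =
    _ , nonneg-* (fromℕ-nonneg 2) (cosθ≥0 m) ,
    trans (*-congˡ x≈) (solve 1 (λ y → two :* (:- y) := :- (two :* y)) refl _) ,
    inj₂ (suc m , U-nonneg-≤ m , U-n m , U-pred-n m)
  admissible {x} (inj₂ x≤-1) = - (fromℕ 2 * x) , ≤-trans (fromℕ-nonneg 2) 2≤c ,
    sym (-‿involutive _) , inj₁ (U-nonneg 2≤c)
    where
    2≤c : fromℕ 2 ≤ - (fromℕ 2 * x)
    2≤c = 0≤y-x⇒x≤y (≤-respʳ-≈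
      (trans (solve 2 (λ u x → two :* (:- u :- x) := :- (two :* x) :- two :* u) refl 1# x)
        (+-congˡ (-‿cong (*-identityʳ _))))
      (nonneg-* (fromℕ-nonneg 2) (x≤y⇒0≤y-x x≤-1)))

  module Dihedral {i j : Fin n} (i≢j : i ≢ j) where

    N M g r : Carrier
    N = ⟨ simple i , simple i ⟩
    M = ⟨ simple j , simple j ⟩
    g = ⟨ simple i , simple j ⟩
    r = proj₁ (simple-angle i≢j)

    r²≈NM : r * r ≈ N * M
    r²≈NM = proj₂ (proj₁ (proj₂ (simple-angle i≢j)))

    r>0 : 0# < r
    r>0 with proj₁ (proj₁ (proj₂ (simple-angle i≢j)))
    ... | inj₁ p = p
    ... | inj₂ e = ⊥-elim (pos⇒≉0 (*-pos (simple-pos i) (simple-pos j))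
      (trans (sym r²≈NM) (trans (*-congʳ (sym e)) (zeroˡ r))))

    angle = admissible (proj₂ (proj₂ (simple-angle i≢j)))

    c : Carrier
    c = proj₁ angle

    c≥0 : 0# ≤ c
    c≥0 = proj₁ (proj₂ angle)

    bounded : Bounded c
    bounded = proj₂ (proj₂ (proj₂ angle))

    2g≈-cr : fromℕ 2 * g ≈ - (c * r)
    2g≈-cr = trans (trans (sym (*-identityʳ _)) (*-congˡ (sym (⁻¹-inverseˡ (pos⇒≉0 r>0)))))
      (trans (solve 3 (λ g i r → two :* g :* (i :* r) := two :* (g :* i) :* r) refl g (r ⁻¹) r)
      (trans (*-congʳ (proj₁ (proj₂ (proj₂ angle))))
        (solve 2 (λ c r → (:- c) :* r := :- (c :* r)) refl c r)))

    letter : ℕ → Fin n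
    letter 0             = i
    letter 1             = j
    letter (suc (suc k)) = letter k

    scale : ℕ → Carrier
    scale 0             = 1#
    -- As r² = N M, the square of this factor is N / M, so the rescaled `simple j` gets the norm N
    -- of `simple i`.
    scale 1             = N * r ⁻¹
    scale (suc (suc k)) = scale k

    scale-pos : ∀ k → 0# < scale k
    scale-pos 0             = 0<1
    scale-pos 1             = *-pos (simple-pos i) (⁻¹-pos r>0)
    scale-pos (suc (suc k)) = scale-pos k

    -- The two simple roots, rescaled to have the same norm.
    e : ℕ → Carrierᴹ
    e k = scale k *ₗ simple (letter k)

    ratio-e : ∀ k → ratio (e k) (simple (letter (suc k))) ≈ - (c * scale (suc k))
    ratio-e 0 = ratio-unique (simple-pos j) (trans
      (solve 4 (λ c N i M → (:- (c :* (N :* i))) :* M := :- (c :* i :* (N :* M))) refl c N (r ⁻¹) M)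
      (trans (-‿cong (trans (*-congˡ (sym r²≈NM))
        (trans (solve 3 (λ c i r → c :* i :* (r :* r) := c :* r :* (i :* r)) refl c (r ⁻¹) r)
        (trans (*-congˡ (⁻¹-inverseˡ (pos⇒≉0 r>0))) (*-identityʳ _)))))
      (trans (sym 2g≈-cr) (*-congˡ (sym (trans (⟨⟩-* 1# _ _) (*-identityˡ g)))))))
    ratio-e 1 = ratio-unique (simple-pos i) (sym (trans (*-congˡ (trans (⟨⟩-* _ _ _) (*-congˡ (⟨⟩-sym _ _))))
      (trans (solve 3 (λ N i g → two :* (N :* i :* g) := two :* g :* (N :* i)) refl N (r ⁻¹) g)
      (trans (*-congʳ 2g≈-cr)
      (trans (solve 4 (λ c r N i → (:- (c :* r)) :* (N :* i) := :- (c :* N :* (i :* r))) refl c r N (r ⁻¹))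
      (trans (-‿cong (*-congˡ (⁻¹-inverseˡ (pos⇒≉0 r>0))))
        (solve 3 (λ c N u → :- (c :* N :* u) := (:- (c :* u)) :* N) refl c N 1#)))))))
    ratio-e (suc (suc k)) = ratio-e k

    -- Equal norms make both reflections act by the same constant c, so a single recurrence serves
    -- both parities of k.
    s-e : ∀ k → s (simple (letter (suc k))) (e k) ≈ᴹ e k +ᴹ c *ₗ e (suc k)
    s-e k = +ᴹ-cong ≈ᴹ-refl (≈ᴹ-trans (-ᴹ‿cong (*ₗ-cong (ratio-e k) ≈ᴹ-refl))
      (proveᴹ (c ∷ scale (suc k) ∷ []) (simple (letter (suc k)) ∷ [])
        (⊖ ((:- (var zero :* var (suc zero))) ⊛ # zero)) (var zero ⊛ var (suc zero) ⊛ # zero) ≡.refl))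

    s-e-self : ∀ k → s (simple (letter k)) (e k) ≈ᴹ -ᴹ e k
    s-e-self k = ≈ᴹ-trans (act-*ₗ (letter k ∷ []) (scale k) _)
      (≈ᴹ-trans (*ₗ-cong refl (s-self _ (simple-pos (letter k))))
        (proveᴹ (scale k ∷ []) (simple (letter k) ∷ []) (var zero ⊛ ⊖ # zero) (⊖ (var zero ⊛ # zero)) ≡.refl))

    -- Letters are prepended: `u k` alternates, has length k and ends in j, so `z k` alternates,
    -- starts with `letter k` and ends in i.
    u : ℕ → Word
    u zero    = []
    u (suc k) = letter (suc k) ∷ u k

    z : ℕ → Word
    z k = u k ++ i ∷ []

    -- The reflection in e (k + 1) negates that vector and adds c e (k + 1) to e k, so the
    -- coefficients obey the recurrence of `U`. The terms match because e (k + 2) is e k by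
    -- definition.
    u-root : ∀ k → act (u k) (simple i) ≈ᴹ U c (suc k) *ₗ e k +ᴹ U c k *ₗ e (suc k)
    u-root zero = ≈ᴹ-sym (≈ᴹ-trans
      (+ᴹ-cong (≈ᴹ-trans (*ₗ-identityˡ _) (*ₗ-identityˡ _)) (*ₗ-zeroˡ _)) (+ᴹ-identityʳ _))
    u-root (suc k) = begin
      s α (act (u k) (simple i))
        ≈⟨ s-cong α (u-root k) ⟩
      s α (U c (suc k) *ₗ e k +ᴹ U c k *ₗ e (suc k))
        ≈⟨ s-linear α _ _ _ ⟩
      U c (suc k) *ₗ s α (e k) +ᴹ s α (U c k *ₗ e (suc k))
        ≈⟨ +ᴹ-cong (*ₗ-cong refl (s-e k)) (≈ᴹ-trans (act-*ₗ (letter (suc k) ∷ []) _ _)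
             (*ₗ-cong refl (s-e-self (suc k)))) ⟩
      U c (suc k) *ₗ (e k +ᴹ c *ₗ e (suc k)) +ᴹ U c k *ₗ (-ᴹ e (suc k))
        ≈⟨ proveᴹ (c ∷ U c (suc k) ∷ U c k ∷ []) (e k ∷ e (suc k) ∷ [])
             ((var (suc zero) ⊛ (# zero ⊕ (var zero ⊛ # suc zero))) ⊕ (var (suc (suc zero)) ⊛ ⊖ # suc zero))
             (((var zero :* var (suc zero) :- var (suc (suc zero))) ⊛ # suc zero) ⊕ (var (suc zero) ⊛ # zero))
             ≡.refl ⟩
      U c (suc (suc k)) *ₗ e (suc k) +ᴹ U c (suc k) *ₗ e k ∎
      where
      α : Carrierᴹ
      α = simple (letter (suc k))

    letter-prefix : ∀ w k → Reduced (w ++ z k) → Reduced (w ++ letter k ∷ [])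
    letter-prefix w zero    red = red
    letter-prefix w (suc k) red = reduced-prefix (w ++ letter (suc k) ∷ []) (z k)
      (≡.subst Reduced (≡.sym (Listₚ.++-assoc w (letter (suc k) ∷ []) (z k))) red)

    z-suffix : ∀ {p k} → p ℕ.≤′ k → Reduced (z k) → Reduced (z p)
    z-suffix ℕ.≤′-refl           red = red
    z-suffix {k = suc k} (ℕ.≤′-step p≤k) red = z-suffix p≤k (reduced-suffix (letter (suc k) ∷ []) (z k) red)

    -- By the two values of `U`, the word u p carries `simple i` to the multiple e (p + 1) of a
    -- simple root, so `conjugate` identifies z (p + 1) with u p, which is shorter by two letters.
    ¬reduced-z : ∀ p → U c (suc p) ≈ 0# → U c p ≈ 1# → ¬ Reduced (z (suc p))
    ¬reduced-z p U≈0 U≈1 red = ℕₚ.<⇒≱ (ℕₚ.m<n⇒m<1+n (≡.subst (length (u p) ℕ.<_)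
      (≡.sym (length-∷ʳ (u p) i)) ℕₚ.≤-refl))
      (minimal red (≋-sym (conjugate (u p) (scale-pos (suc p)) (begin
        act (u p) (simple i)
          ≈⟨ u-root p ⟩
        U c (suc p) *ₗ e p +ᴹ U c p *ₗ e (suc p)
          ≈⟨ +ᴹ-cong (*ₗ-cong U≈0 ≈ᴹ-refl) (*ₗ-cong U≈1 ≈ᴹ-refl) ⟩
        0# *ₗ e p +ᴹ 1# *ₗ e (suc p)
          ≈⟨ +ᴹ-cong (*ₗ-zeroˡ _) (*ₗ-identityˡ _) ⟩
        0ᴹ +ᴹ e (suc p)
          ≈⟨ +ᴹ-identityˡ _ ⟩
        e (suc p) ∎))))

    -- Reducedness keeps k below the order of the rotation, hence in the range where `U` is
    -- nonnegative.
    U-reduced : ∀ k → Reduced (z k) → 0# ≤ U c k × 0# ≤ U c (suc k)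
    U-reduced k red with bounded
    ... | inj₁ U≥0 = U≥0 k , U≥0 (suc k)
    ... | inj₂ (p , U≥0 , U≈0 , U≈1) = U≥0 (ℕₚ.m≤n⇒m≤1+n k≤p) , U≥0 (ℕ.s≤s k≤p)
      where
      k≤p : k ℕ.≤ p
      k≤p = ℕₚ.≮⇒≥ λ p<k → ¬reduced-z p U≈0 U≈1 (z-suffix (ℕₚ.≤⇒≤′ p<k) red)

  simple-obtuse : ∀ {i j} → i ≢ j → 0# ≤ - (fromℕ 2 * ⟨ simple i , simple j ⟩)
  simple-obtuse i≢j = ≤-respʳ-≈ (trans (sym (-‿involutive _)) (-‿cong (sym 2g≈-cr)))
    (nonneg-* c≥0 (inj₁ r>0))
    where open Dihedral i≢j

  -- Used for the cone over Π, and for positive roots with a translate in a closed set of `d`. In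
  -- the latter P makes sense on roots only, so `cone∈` provides that its vectors are roots.
  record TwoConeClosed (P : Pred Carrierᴹ 0ℓ) : Set where
    field
      resp   : ∀ {u v} → u ≈ᴹ v → P u → P v
      simple∈ : ∀ i → P (simple i)
      cone∈  : ∀ {x y v a b} → Φ x → Φ y → Φ v → 0# ≤ a → 0# ≤ b →
               v ≈ᴹ a *ₗ x +ᴹ b *ₗ y → P x → P y → P v

  module _ {P : Pred Carrierᴹ 0ℓ} (closed : TwoConeClosed P) where
    open TwoConeClosed closed

    -- Among the decompositions w s_i = w′ z, with z an alternating word in
    -- s_i and s_j, one with w′ shortest reduces the claim to the plane of
    -- the two simple roots and to w′.
    reduced∈ : ∀ k w i → length w ℕ.< k → Reduced (w ++ i ∷ []) → P (act w (simple i))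
    reduced∈ (suc k) w i (ℕ.s≤s w≤k) red with initLast w
    ... | []       = simple∈ i
    ... | x ∷ʳ′ j with i Finₚ.≟ j
    ...   | yes ≡.refl = ⊥-elim (ℕₚ.<⇒≱ shorter (minimal red (≋-sym (≋-trans same (≋-double x i [])))))
      where
      same : (x ++ i ∷ []) ++ i ∷ [] ≋ x ++ i ∷ i ∷ []
      same = ≋-reflexive (Listₚ.++-assoc x (i ∷ []) (i ∷ []))
      shorter : length (x ++ []) ℕ.< length ((x ++ i ∷ []) ++ i ∷ [])
      shorter = ≡.subst₂ ℕ._<_ (≡.cong length (≡.sym (Listₚ.++-identityʳ x)))
        (≡.sym (≡.trans (length-∷ʳ (x ++ i ∷ []) i) (≡.cong suc (length-∷ʳ x i))))
        (ℕₚ.m<n⇒m<1+n (ℕₚ.n<1+n (length x)))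
    ...   | no i≢j = resp (≈ᴹ-reflexive (≡.sym (act-++ x (j ∷ []) (simple i))))
      -- The word j i is `z 1`, so the descent starts from this factorisation.
      (descend (suc (length x)) x 1 ℕₚ.≤-refl
        (ℕₚ.<-≤-trans (≡.subst (length x ℕ.<_) (≡.sym (length-∷ʳ x j)) ℕₚ.≤-refl) w≤k)
        (≡.subst Reduced (Listₚ.++-assoc x (j ∷ []) (i ∷ [])) red))
      where
      open Dihedral i≢j
      descend : ∀ f x m → length x ℕ.< f → length x ℕ.< k → Reduced (x ++ z m) →
                P (act x (act (u m) (simple i)))
      descend (suc f) x m (ℕ.s≤s x≤f) x<k red with reduced-or-shorter (x ++ letter (suc m) ∷ [])
      -- Now x followed by either letter is reduced: one word is a prefix of x z, the other is
      -- reduced by this case. The outer induction treats both roots, and the target combines them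
      -- with the coefficients of `u-root`.
      ... | inj₁ red′ = cone∈ (x , letter m , ≈ᴹ-refl) (x , letter (suc m) , ≈ᴹ-refl)
        (act-Φ x (u m , i , ≈ᴹ-refl))
        (nonneg-* (proj₂ U≥0) (inj₁ (scale-pos m))) (nonneg-* (proj₁ U≥0) (inj₁ (scale-pos (suc m))))
        (begin
          act x (act (u m) (simple i))
            ≈⟨ act-cong x (u-root m) ⟩
          act x (U c (suc m) *ₗ e m +ᴹ U c m *ₗ e (suc m))
            ≈⟨ act-linear x _ _ _ ⟩
          U c (suc m) *ₗ act x (e m) +ᴹ act x (U c m *ₗ e (suc m))
            ≈⟨ +ᴹ-cong (*ₗ-cong refl (act-*ₗ x _ _)) (≈ᴹ-trans (act-*ₗ x _ _) (*ₗ-cong refl (act-*ₗ x _ _))) ⟩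
          U c (suc m) *ₗ scale m *ₗ act x (simple (letter m)) +ᴹ
          U c m *ₗ scale (suc m) *ₗ act x (simple (letter (suc m)))
            ≈⟨ +ᴹ-cong (*ₗ-assoc _ _ _) (*ₗ-assoc _ _ _) ⟨
          (U c (suc m) * scale m) *ₗ act x (simple (letter m)) +ᴹ
          (U c m * scale (suc m)) *ₗ act x (simple (letter (suc m))) ∎)
        (reduced∈ k x (letter m) x<k (letter-prefix x m red))
        (reduced∈ k x (letter (suc m)) x<k red′)
        where
        U≥0 : 0# ≤ U c m × 0# ≤ U c (suc m)
        U≥0 = U-reduced m (reduced-suffix x (z m) red)
      -- The letter moves from the prefix into the alternating part: x z m = y z (m + 1), no longer
      -- than before and hence still reduced, with y shorter than x.
      ... | inj₂ (y , y≋ , y<) = resp (begin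
          act y (s α (act (u m) (simple i)))
            ≈⟨ same-action y≋ _ ⟩
          act (x ++ letter (suc m) ∷ []) (s α (act (u m) (simple i)))
            ≡⟨ act-++ x (letter (suc m) ∷ []) _ ⟩
          act x (s α (s α (act (u m) (simple i))))
            ≈⟨ act-cong x (s-involutive (simple-pos (letter (suc m))) _) ⟩
          act x (act (u m) (simple i)) ∎)
        (descend f y (suc m) (ℕₚ.<-≤-trans y<x x≤f) (ℕₚ.<-trans y<x x<k)
          (reduced-resp y≋′ y≤ red))
        where
        α : Carrierᴹ
        α = simple (letter (suc m))
        y<x : length y ℕ.< length x
        y<x = shorter-by-two x (letter (suc m)) y≋ y<
        y≋′ : y ++ z (suc m) ≋ x ++ z m
        y≋′ = ≋-trans (≋-++ y≋ (≋-refl {z (suc m)}))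
          (≋-trans (≋-reflexive (Listₚ.++-assoc x (letter (suc m) ∷ []) (z (suc m))))
            (≋-double x (letter (suc m)) (z m)))
        y≤ : length (y ++ z (suc m)) ℕ.≤ length (x ++ z m)
        y≤ = ≡.subst₂ ℕ._≤_
          (≡.trans (≡.sym (ℕₚ.+-suc (length y) (length (z m)))) (≡.sym (Listₚ.length-++ y)))
          (≡.sym (Listₚ.length-++ x)) (ℕₚ.+-monoˡ-≤ (length (z m)) y<x)

    -- Take w reduced. If w s_α is not reduced, a shorter form y of it satisfies w = y s_α, and - wα
    -- = yα falls under the reduced case.
    root∈ : ∀ {v} → Φ v → P v ⊎ P (-ᴹ v)
    root∈ {v} (w , i , e) with reduced-form w
    ... | x , x≋w , red with reduced-or-shorter (x ++ i ∷ [])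
    ... | inj₁ red′ = inj₁ (resp (≈ᴹ-trans (same-action x≋w _) (≈ᴹ-sym e))
      (reduced∈ (suc (length x)) x i ℕₚ.≤-refl red′))
    ... | inj₂ (y , y≋ , y<) = inj₂ (resp (begin
        act y (simple i)                  ≈⟨ same-action y≋ _ ⟩
        act (x ++ i ∷ []) (simple i)      ≈⟨ act-neg-simple x i ⟩
        -ᴹ act x (simple i)               ≈⟨ -ᴹ‿cong (≈ᴹ-trans (same-action x≋w _) (≈ᴹ-sym e)) ⟩
        -ᴹ v                              ∎)
      (reduced∈ (suc (length y)) y i ℕₚ.≤-refl (reduced-resp yi≋x yi≤x red)))
      where
      y<x : length y ℕ.< length x
      y<x = shorter-by-two x i y≋ y<
      yi≋x : y ++ i ∷ [] ≋ x
      yi≋x = ≋-trans (≋-++ y≋ (≋-refl {i ∷ []}))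
        (≋-trans (≋-reflexive (Listₚ.++-assoc x (i ∷ []) (i ∷ [])))
        (≋-trans (≋-double x i []) (≋-reflexive (Listₚ.++-identityʳ x))))
      yi≤x : length (y ++ i ∷ []) ℕ.≤ length x
      yi≤x = ≡.subst (ℕ._≤ length x) (≡.sym (length-∷ʳ y i)) y<x

-- Positive roots and simple reflections.

module PositiveRoots (em : ExcludedMiddle 0ℓ) {ℝ : RealField} {trig : Trigonometry ℝ}
                     (R : RootSystem ℝ trig) where
  open RealField ℝ
  open RootSystem R
  open Reflections R
  open Words em R
  open ConeStructure em R using (≈ᴹ⇒∼; ∼-sym)
  open LinearTerms commutativeRing V using (linear-+; linear-0; linear-cong)
  open import Relation.Binary.Reasoning.Setoid ≈ᴹ-setoid

  combination-updateAt : ∀ {k} (c : Vector Carrier k) a i x →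
    combination (Vector.updateAt c i (x +_)) a ≈ᴹ x *ₗ a i +ᴹ combination c a
  combination-updateAt c a zero x =
    ≈ᴹ-trans (+ᴹ-cong (*ₗ-distribʳ _ _ _) ≈ᴹ-refl) (+ᴹ-assoc _ _ _)
  combination-updateAt c a (suc i) x = begin
    c zero *ₗ a zero +ᴹ combination (Vector.updateAt (c ∘ suc) i (x +_)) (a ∘ suc)
      ≈⟨ +ᴹ-cong ≈ᴹ-refl (combination-updateAt (c ∘ suc) (a ∘ suc) i x) ⟩
    c zero *ₗ a zero +ᴹ (x *ₗ a (suc i) +ᴹ combination (c ∘ suc) (a ∘ suc))
      ≈⟨ proveᴹ [] (c zero *ₗ a zero ∷ x *ₗ a (suc i) ∷ combination (c ∘ suc) (a ∘ suc) ∷ [])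
           (# zero ⊕ (# suc zero ⊕ # suc (suc zero))) (# suc zero ⊕ (# zero ⊕ # suc (suc zero))) ≡.refl ⟩
    x *ₗ a (suc i) +ᴹ (c zero *ₗ a zero +ᴹ combination (c ∘ suc) (a ∘ suc)) ∎

  updateAt-nonneg : ∀ {k} (c : Vector Carrier k) → NonNegative c → ∀ i {x} → 0# ≤ x →
                    NonNegative (Vector.updateAt c i (x +_))
  updateAt-nonneg c c≥0 zero    x≥0 zero    = +-nonneg x≥0 (c≥0 zero)
  updateAt-nonneg c c≥0 zero    x≥0 (suc j) = c≥0 (suc j)
  updateAt-nonneg c c≥0 (suc i) x≥0 zero    = c≥0 zero
  updateAt-nonneg c c≥0 (suc i) x≥0 (suc j) = updateAt-nonneg (c ∘ suc) (c≥0 ∘ suc) i x≥0 j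

  -- A member of the cone may list a simple root repeatedly; collecting the terms allows
  -- `positivelyIndependent` to be applied.
  cone-Π-coefficients : ∀ {v} → Cone Π v → ∃[ c ] NonNegative c × v ≈ᴹ combination c simple
  cone-Π-coefficients = cone-rec Π (λ v → ∃[ c ] NonNegative c × v ≈ᴹ combination c simple)
    (λ { e (c , c≥0 , f) → c , c≥0 , ≈ᴹ-trans (≈ᴹ-sym e) f })
    ((λ _ → 0#) , (λ _ → ≤-refl) , ≈ᴹ-sym (linear-0 simple))
    (λ { x≥0 (i , a≈) (c , c≥0 , f) → Vector.updateAt c i (_ +_) , updateAt-nonneg c c≥0 i x≥0 ,
         ≈ᴹ-trans (+ᴹ-cong (*ₗ-cong refl a≈) f) (≈ᴹ-sym (combination-updateAt c simple i _)) })

  cone-Π-salient : ∀ {u v} → Cone Π u → Cone Π v → u +ᴹ v ≈ᴹ 0ᴹ → u ≈ᴹ 0ᴹ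
  cone-Π-salient u∈ v∈ e with cone-Π-coefficients u∈ | cone-Π-coefficients v∈
  ... | c , c≥0 , u≈ | d , d≥0 , v≈ = ≈ᴹ-trans u≈ (≈ᴹ-trans (linear-cong simple c≈0) (linear-0 simple))
    where
    c+d≈0 : ∀ i → c i + d i ≈ 0#
    c+d≈0 = positivelyIndependent (λ i → c i + d i) (λ i → +-nonneg (c≥0 i) (d≥0 i))
      (≈ᴹ-trans (≈ᴹ-sym (≈ᴹ-trans (+ᴹ-cong u≈ v≈) (linear-+ simple c d))) e)
    c≈0 : ∀ i → c i ≈ 0#
    c≈0 i with c≥0 i
    ... | inj₁ p = ⊥-elim (pos⇒≉0 (+-pos-nonneg p (d≥0 i)) (c+d≈0 i))
    ... | inj₂ p = sym p

  not-both-signs : ∀ {v} → Φ v → Cone Π v → ¬ Cone Π (-ᴹ v)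
  not-both-signs p v∈ -v∈ = root-≉0 p (cone-Π-salient v∈ -v∈ (-ᴹ‿inverseʳ _))

  cone-Π-closed : TwoConeClosed (Cone Π)
  cone-Π-closed = record
    { resp    = cone-resp Π
    ; simple∈ = λ i → cone-∋ Π (i , ≈ᴹ-refl)
    ; cone∈   = λ _ _ _ a≥0 b≥0 e x∈ y∈ → cone-resp Π (≈ᴹ-sym e)
        (cone-+ Π (cone-*ₗ Π a≥0 x∈) (cone-*ₗ Π b≥0 y∈))
    }

  positive-or-negative : ∀ {v} → Φ v → Cone Π v ⊎ Cone Π (-ᴹ v)
  positive-or-negative = root∈ cone-Π-closed

  module _ (i : Fin n) where
    private
      α : Carrierᴹ
      α = simple i
      Π∖α : Pred Carrierᴹ 0ℓ
      Π∖α v = ∃[ j ] i ≢ j × v ≈ᴹ simple j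

    cone-Π-split : ∀ {v} → Cone Π v → ∃[ c ] ∃[ w ] 0# ≤ c × Cone Π∖α w × v ≈ᴹ w +ᴹ c *ₗ α
    cone-Π-split = cone-rec Π Q
      (λ { e (c , w , c≥0 , w∈ , f) → c , w , c≥0 , w∈ , ≈ᴹ-trans (≈ᴹ-sym e) f })
      (0# , 0ᴹ , ≤-refl , cone-0 Π∖α ,
        ≈ᴹ-sym (≈ᴹ-trans (+ᴹ-cong ≈ᴹ-refl (*ₗ-zeroˡ _)) (+ᴹ-identityˡ 0ᴹ)))
      step
      where
      Q : Pred Carrierᴹ 0ℓ
      Q v = ∃[ c ] ∃[ w ] 0# ≤ c × Cone Π∖α w × v ≈ᴹ w +ᴹ c *ₗ α
      step : ∀ {x a v} → 0# ≤ x → Π a → Q v → Q (x *ₗ a +ᴹ v)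
      step {x} {a} {v} x≥0 (j , a≈) (c , w , c≥0 , w∈ , f) with i Finₚ.≟ j
      ... | no i≢j = c , x *ₗ a +ᴹ w , c≥0 , cone-∷ Π∖α x≥0 (j , i≢j , a≈) w∈ ,
        ≈ᴹ-trans (+ᴹ-cong ≈ᴹ-refl f) (≈ᴹ-sym (+ᴹ-assoc _ _ _))
      ... | yes ≡.refl = x + c , w , +-nonneg x≥0 c≥0 , w∈ ,
        ≈ᴹ-trans (+ᴹ-cong (*ₗ-cong refl a≈) f)
          (proveᴹ (x ∷ c ∷ []) (α ∷ w ∷ [])
            ((var zero ⊛ # zero) ⊕ (# suc zero ⊕ (var (suc zero) ⊛ # zero)))
            (# suc zero ⊕ ((var zero :+ var (suc zero)) ⊛ # zero)) ≡.refl)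

    cone-obtuse : ∀ {v} → Cone Π∖α v → 0# ≤ - (fromℕ 2 * ⟨ v , α ⟩)
    cone-obtuse = cone-rec Π∖α (λ v → 0# ≤ - (fromℕ 2 * ⟨ v , α ⟩))
      (λ e → ≤-respʳ-≈ (-‿cong (*-congˡ (⟨⟩-cong e ≈ᴹ-refl))))
      (inj₂ (sym (trans (-‿cong (trans (*-congˡ (⟨⟩-0 α)) (zeroʳ _))) -0#≈0#)))
      (λ { {x} {a} {v} x≥0 (j , i≢j , a≈) v≥0 → ≤-respʳ-≈
        (trans (solve 3 (λ x a b → x :* (:- (two :* a)) :+ (:- (two :* b)) := :- (two :* (x :* a :+ b)))
            refl x ⟨ a , α ⟩ ⟨ v , α ⟩)
          (-‿cong (*-congˡ (sym (trans (⟨⟩-+ _ v α) (+-congʳ (⟨⟩-* x a α)))))))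
        (+-nonneg (nonneg-* x≥0 (≤-respʳ-≈
          (-‿cong (*-congˡ (trans (⟨⟩-sym _ _) (⟨⟩-cong (≈ᴹ-sym a≈) ≈ᴹ-refl))))
          (simple-obtuse i≢j))) v≥0) })
      where open RingProperties ring using (-0#≈0#)

    Π∖α⊆Π : ∀ {v} → Cone Π∖α v → Cone Π v
    Π∖α⊆Π = cone-trans Π∖α Π λ { (j , _ , e) → cone-∋ Π (j , e) }

    -- If v and - s_α v are both positive, their sum is a multiple q α.  The
    -- remaining simple roots cancel if q is small, and α would have to be
    -- orthogonal or obtuse to itself if q is large.
    simple-reflection-positive : (x : Root) → Cone Π (proj₁ x) → ¬ (x ∼ (α , [] , i , ≈ᴹ-refl)) →
                                 Cone Π (s α (proj₁ x))
    simple-reflection-positive x@(v , p) v∈ v≁α with positive-or-negative (act-Φ (i ∷ []) p)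
    ... | inj₁ sv∈ = sv∈
    ... | inj₂ -sv∈ with cone-Π-split v∈ | cone-Π-split -sv∈
    ... | c , w , c≥0 , w∈ , e | d , w′ , d≥0 , w′∈ , f = ⊥-elim (absurd (≤-total q (c + d)))
      where
      q : Carrier
      q = ratio v α
      w-vanishes : ¬ (w ≈ᴹ 0ᴹ)
      w-vanishes w≈0 = v≁α (∼-sym (α , [] , i , ≈ᴹ-refl) x (c , positive c≥0 , v≈cα))
        where
        v≈cα : v ≈ᴹ c *ₗ α
        v≈cα = ≈ᴹ-trans e (≈ᴹ-trans (+ᴹ-cong w≈0 ≈ᴹ-refl) (+ᴹ-identityˡ _))
        positive : 0# ≤ c → 0# < c
        positive (inj₁ c>0) = c>0
        positive (inj₂ 0≈c) = ⊥-elim (root-≉0 p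
          (≈ᴹ-trans v≈cα (≈ᴹ-trans (*ₗ-cong (sym 0≈c) ≈ᴹ-refl) (*ₗ-zeroˡ _))))
      relation : (w +ᴹ c *ₗ α) +ᴹ (w′ +ᴹ d *ₗ α) ≈ᴹ q *ₗ α
      relation = ≈ᴹ-trans (+ᴹ-cong (≈ᴹ-sym e) (≈ᴹ-sym f))
        (proveᴹ (q ∷ []) (α ∷ v ∷ []) (# suc zero ⊕ ⊖ (# suc zero ⊕ ⊖ (var zero ⊛ # zero)))
          (var zero ⊛ # zero) ≡.refl)
      small : q ≤ c + d → ⊥
      small q≤ = w-vanishes (cone-Π-salient (Π∖α⊆Π w∈)
        (cone-+ Π (Π∖α⊆Π w′∈) (cone-*ₗ Π (x≤y⇒0≤y-x q≤) (cone-∋ Π (i , ≈ᴹ-refl))))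
        (begin
          w +ᴹ (w′ +ᴹ (c + d - q) *ₗ α)
            ≈⟨ proveᴹ (c ∷ d ∷ q ∷ []) (α ∷ w ∷ w′ ∷ [])
                 (# suc zero ⊕ (# suc (suc zero) ⊕
                   ((var zero :+ var (suc zero) :- var (suc (suc zero))) ⊛ # zero)))
                 (((# suc zero ⊕ (var zero ⊛ # zero)) ⊕ (# suc (suc zero) ⊕ (var (suc zero) ⊛ # zero)))
                   ⊕ ⊖ (var (suc (suc zero)) ⊛ # zero)) ≡.refl ⟩
          ((w +ᴹ c *ₗ α) +ᴹ (w′ +ᴹ d *ₗ α)) +ᴹ -ᴹ (q *ₗ α)
            ≈⟨ +ᴹ-cong relation ≈ᴹ-refl ⟩
          q *ₗ α +ᴹ -ᴹ (q *ₗ α)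
            ≈⟨ -ᴹ‿inverseʳ _ ⟩
          0ᴹ ∎))
      large : c + d < q → ⊥
      large <q = ≤⇒≯ (cone-obtuse (cone-+ Π∖α w∈ w′∈)) (0<y-x⇒x<y (<-respʳ-≈
        (trans (solve 3 (λ u k N → (u :+ u) :* (k :* N) :=
                   con (ℤ.+ 0) :- (:- ((u :+ u) :* (k :* N)))) refl 1# (q - (c + d)) ⟨ α , α ⟩)
          (+-congˡ (-‿cong (-‿cong (*-cong (+-congˡ (sym (+-identityʳ 1#)))
            (trans (sym (⟨⟩-* _ α α)) (⟨⟩-cong (≈ᴹ-sym sum≈) ≈ᴹ-refl)))))))
        (*-pos (+-pos-nonneg 0<1 0≤1) (*-pos (x<y⇒0<y-x <q) (simple-pos i)))))
        where
        sum≈ : w +ᴹ w′ ≈ᴹ (q - (c + d)) *ₗ α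
        sum≈ = begin
          w +ᴹ w′
            ≈⟨ proveᴹ (c ∷ d ∷ []) (α ∷ w ∷ w′ ∷ []) (# suc zero ⊕ # suc (suc zero))
                 (((# suc zero ⊕ (var zero ⊛ # zero)) ⊕ (# suc (suc zero) ⊕ (var (suc zero) ⊛ # zero)))
                   ⊕ ⊖ ((var zero :+ var (suc zero)) ⊛ # zero)) ≡.refl ⟩
          ((w +ᴹ c *ₗ α) +ᴹ (w′ +ᴹ d *ₗ α)) +ᴹ -ᴹ ((c + d) *ₗ α)
            ≈⟨ +ᴹ-cong relation ≈ᴹ-refl ⟩
          q *ₗ α +ᴹ -ᴹ ((c + d) *ₗ α)
            ≈⟨ proveᴹ (q ∷ c + d ∷ []) (α ∷ []) ((var zero ⊛ # zero) ⊕ ⊖ (var (suc zero) ⊛ # zero))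
                 ((var zero :- var (suc zero)) ⊛ # zero) ≡.refl ⟩
          (q - (c + d)) *ₗ α ∎
      absurd : ¬ (q ≤ c + d ⊎ c + d ≤ q)
      absurd (inj₁ q≤)        = small q≤
      absurd (inj₂ (inj₁ <q)) = large <q
      absurd (inj₂ (inj₂ ≈q)) = small (inj₂ (sym ≈q))

-- Chambers and uniqueness.

module Chambers (em : ExcludedMiddle 0ℓ) {ℝ : RealField} {trig : Trigonometry ℝ}
                (R : RootSystem ℝ trig) where
  open RealField ℝ
  open RootSystem R
  open Reflections R
  open Words em R
  open PositiveRoots em R
  open ConeStructure em R
  open SubsetOps Rays hiding (Finite)
  open SetoidMembership Rays using () renaming (_∈_ to _∈ᴸ_)
  open Counting em Rays
  open ModuleProperties V using (-ᴹ-involutive)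
  open import Relation.Binary.Reasoning.Setoid ≈ᴹ-setoid

  translate-cong : ∀ w x y → x ∼ y → translate w x ∼ translate w y
  translate-cong w x y (c , c>0 , e) = c , c>0 , ≈ᴹ-trans (act-cong w e) (act-*ₗ w c _)

  translate-reverse : ∀ w x → translate w (translate (reverse w) x) ∼ x
  translate-reverse w x =
    ≈ᴹ⇒∼ (proj₂ (translate w (translate (reverse w) x))) (proj₂ x) (act-reverseʳ w (proj₁ x))

  simpleRoot : Fin n → Root
  simpleRoot i = simple i , [] , i , ≈ᴹ-refl

  -- Membership in wΦ⁺ is tested by pulling back along the inverse of w, which the reversed word
  -- represents.
  chamber : Word → Subset Rays
  chamber w = subset (λ x → Cone Π (act (reverse w) (proj₁ x))) λ {x} {y} x∼y →
    cone-∼ Π {translate (reverse w) x} {translate (reverse w) y}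
      (translate-cong (reverse w) x y x∼y)

  chamber-complete : ∀ w x → x ∈ chamber w ⊎ negate x ∈ chamber w
  chamber-complete w x = Sum.map₂ (cone-resp Π (≈ᴹ-sym (act-neg (reverse w) _)))
    (positive-or-negative (proj₂ (translate (reverse w) x)))

  chamber-acyclic : ∀ w x → x ∈ chamber w → negate x ∉ chamber w
  chamber-acyclic w x x∈ -x∈ = not-both-signs (proj₂ (translate (reverse w) x)) x∈
    (cone-resp Π (act-neg (reverse w) _) -x∈)

  -- Right multiplication by a simple reflection leads to the chamber across the wall of wα; in the
  -- inverse this reflection acts last.
  ∷ʳ-chamber : ∀ w i {v} → Cone Π (s (simple i) (act (reverse w) v)) →
               Cone Π (act (reverse (w ++ i ∷ [])) v)
  ∷ʳ-chamber w i {v} = ≡.subst (λ u → Cone Π (act u v)) (≡.sym (Listₚ.reverse-++ w (i ∷ [])))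

  module Structure (d : Subset Rays → Subset Rays) (isOMRS : IsOMRS d) where
    open IsOMRS isOMRS
    open IsOrientedMatroid isOrientedMatroid using (isClosureOperator)
    open IsClosureOperator isClosureOperator public
    open ReducedOrientedMatroid em Rays negate d isOrientedMatroid isReduced public

    -- Equivariance carries `positive-closed` from Φ⁺ to wΦ⁺.
    chamber-closed : ∀ w → d (chamber w) ⊆ chamber w
    chamber-closed w {y} y∈ =
      image⊆ y (proj₁ (equivariant positiveRays w) {y}
        (monotone {chamber w} {image (translate w) positiveRays} (λ {x} → ⊆image x) {y} y∈))
      where
      ⊆image : ∀ x → x ∈ chamber w → x ∈ image (translate w) positiveRays
      ⊆image x x∈ = translate (reverse w) x , cone⇒positive (translate (reverse w) x) x∈ ,
        ∼-sym (translate w (translate (reverse w) x)) x (translate-reverse w x)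
      image⊆ : ∀ y → y ∈ image (translate w) (d positiveRays) → y ∈ chamber w
      image⊆ y (x , x∈ , y∼wx) = Subset.resp (chamber w) {translate w x} {y}
        (∼-sym y (translate w x) y∼wx)
        (cone-resp Π (≈ᴹ-sym (act-reverse w (proj₁ x)))
          (positive⇒cone x (proj₁ positive-closed {x} x∈)))

    -- The hypothesis does not mention `d`; through this lemma acyclicity passes between structures.
    ⊆-chamber-acyclic : ∀ X w → X ⊆ chamber w → Acyclic X
    ⊆-chamber-acyclic X w X⊆ x x∈ x*∈ = chamber-acyclic w x (closed x x∈) (closed (negate x) x*∈)
      where
      closed : ∀ x → x ∈ d X → x ∈ chamber w
      closed x x∈ = chamber-closed w {x} (monotone {X} {chamber w} (λ {z} → X⊆ {z}) {x} x∈)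

    -- `rank-two` is applied to the pair x, y. Its representatives span a space for which these two
    -- vectors serve as generators, even when they are proportional.
    two-cone : ∀ Z x y z {a b} → x ∈ d Z → y ∈ d Z → 0# ≤ a → 0# ≤ b →
               proj₁ z ≈ᴹ a *ₗ proj₁ x +ᴹ b *ₗ proj₁ y → z ∈ d Z
    two-cone Z x@(u , p) y@(v , q) z {a} {b} x∈ y∈ a≥0 b≥0 e = cx-least {X} {Z}
      (λ { {t} (inj₁ t∼x) → cx-resp Z {x} {t} (∼-sym t x t∼x) x∈
         ; {t} (inj₂ t∼y) → cx-resp Z {y} {t} (∼-sym t y t∼y) y∈ })
      {z} (proj₂ (rank-two X planar) {z}
        (cone-resp (Representatives X) (≈ᴹ-trans (+ᴹ-cong ≈ᴹ-refl (+ᴹ-identityʳ _)) (≈ᴹ-sym e))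
          (cone-∷ (Representatives X) a≥0 (p , inj₁ (∼-refl x))
            (cone-∷ (Representatives X) b≥0 (q , inj₂ (∼-refl y)) (cone-0 (Representatives X))))))
      where
      X : Subset Rays
      X = ｛ x ｝ ∪ ｛ y ｝
      basis : Vector Carrierᴹ 2
      basis = u Vector.∷ v Vector.∷ Vector.[]
      generator : ∀ {w} → Representatives X w → Span (Representatives X) w
      generator {w} w∈ = 1 , (λ _ → 1#) , (λ _ → w) , (λ _ → w∈) ,
        ≈ᴹ-sym (≈ᴹ-trans (+ᴹ-identityʳ _) (*ₗ-identityˡ w))
      expand : ∀ k c (a : Vector Carrierᴹ k) → (∀ i → Representatives X (a i)) →
               ∃[ c′ ] combination c a ≈ᴹ combination c′ basis
      expand zero c a a∈ = (λ _ → 0#) , ≈ᴹ-sym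
        (proveᴹ [] (u ∷ v ∷ []) ((con (ℤ.+ 0) ⊛ # zero) ⊕ ((con (ℤ.+ 0) ⊛ # suc zero) ⊕ 𝟎)) 𝟎 ≡.refl)
      expand (suc k) c a a∈ with expand k (c ∘ suc) (a ∘ suc) (a∈ ∘ suc)
      ... | c′ , f with a∈ zero
      ... | r , inj₁ a∼x with ∼-sym (a zero , r) x a∼x
      ...   | t , _ , g = Vector.updateAt c′ zero (c zero * t +_) ,
        ≈ᴹ-trans (+ᴹ-cong (≈ᴹ-trans (*ₗ-cong refl g) (≈ᴹ-sym (*ₗ-assoc _ _ _))) f)
          (≈ᴹ-sym (combination-updateAt c′ basis zero _))
      expand (suc k) c a a∈ | c′ , f | r , inj₂ a∼y with ∼-sym (a zero , r) y a∼y
      ...   | t , _ , g = Vector.updateAt c′ (suc zero) (c zero * t +_) ,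
        ≈ᴹ-trans (+ᴹ-cong (≈ᴹ-trans (*ₗ-cong refl g) (≈ᴹ-sym (*ₗ-assoc _ _ _))) f)
          (≈ᴹ-sym (combination-updateAt c′ basis (suc zero) _))
      planar : DimensionAtMost 2 (Span (Representatives X))
      planar = basis ,
        (λ { zero → generator (p , inj₁ (∼-refl x)) ; (suc zero) → generator (q , inj₂ (∼-refl y)) }) ,
        λ { (k , c , a , a∈ , f) → let c′ , g = expand k c a a∈ in c′ , ≈ᴹ-trans f g }

    chamber⊆ : ∀ Z w → (∀ i → translate w (simpleRoot i) ∈ d Z) → chamber w ⊆ d Z
    chamber⊆ Z w simple∈dZ {x} x∈ with root∈ closed (proj₂ (translate (reverse w) x))
      where
      P : Pred Carrierᴹ 0ℓ
      -- The conjunct on the cone rules out the branch of `root∈` that concerns the opposite root.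
      P v = Cone Π v × Σ[ p ∈ Φ v ] translate w (v , p) ∈ d Z
      closed : TwoConeClosed P
      closed = record
        { resp    = λ { {u} {v} e (u∈ , p , wu∈) → cone-resp Π e u∈ , Φ-resp e p ,
                        cx-resp Z {translate w (u , p)} {translate w (v , Φ-resp e p)}
                          (≈ᴹ⇒∼ (act-Φ w p) (act-Φ w (Φ-resp e p)) (act-cong w e)) wu∈ }
        ; simple∈ = λ i → cone-∋ Π (i , ≈ᴹ-refl) , proj₂ (simpleRoot i) , simple∈dZ i
        ; cone∈   = λ { {a = a} {b} px py p a≥0 b≥0 e (x∈ , qx , wx∈) (y∈ , qy , wy∈) →
            TwoConeClosed.cone∈ cone-Π-closed px py p a≥0 b≥0 e x∈ y∈ , p ,
            two-cone Z (translate w (_ , qx)) (translate w (_ , qy)) (translate w (_ , p)) wx∈ wy∈ a≥0 b≥0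
              (≈ᴹ-trans (act-cong w e) (≈ᴹ-trans (act-linear w _ _ _) (+ᴹ-cong ≈ᴹ-refl (act-*ₗ w _ _)))) }
        }
    ... | inj₁ (_ , p , wx∈) = cx-resp Z {translate w (act (reverse w) (proj₁ x) , p)} {x}
      (≈ᴹ⇒∼ (act-Φ w p) (proj₂ x) (act-reverseʳ w (proj₁ x))) wx∈
    ... | inj₂ (-x∈ , _) = ⊥-elim (not-both-signs (proj₂ (translate (reverse w) x)) x∈ -x∈)

    hemispace-chamber : ∀ xs → (∀ x → x ∈ᴸ xs) → ∀ Z → Acyclic Z → CompleteOn xs Z →
                        ∃[ w ] d Z ⊆ chamber w
    hemispace-chamber xs covers Z acyclic complete = go _ [] ℕₚ.≤-refl
      where
      outside : Word → Subset Rays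
      outside w = d Z ∖ chamber w
      go : ∀ k w → count (outside w) xs ℕ.< k → ∃[ w ] d Z ⊆ chamber w
      go (suc k) w (ℕ.s≤s bound) with em {P = ∃[ i ] translate w (simpleRoot i) ∉ d Z}
      -- The chamber lies in d Z here. A member of d Z outside it would have its opposite in the
      -- chamber, hence in d Z, against acyclicity.
      ... | no none = w , λ {x} x∈ → Sum.fromInj₁
        (λ -x∈ → ⊥-elim (acyclic x x∈ (chamber⊆ Z w all-simple {negate x} -x∈)))
        (chamber-complete w x)
        where
        all-simple : ∀ i → translate w (simpleRoot i) ∈ d Z
        all-simple i with em {P = translate w (simpleRoot i) ∈ d Z}
        ... | yes p = p
        ... | no ¬p = ⊥-elim (none (i , ¬p))
      -- Crossing the wall removes from the chamber only the ray of wα, which is not in d Z, and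
      -- gains its opposite, which is. So strictly fewer rays of d Z remain outside.
      ... | yes (i , wα∉) = go k w′ (ℕₚ.<-≤-trans
        (count-< (outside w′) (outside w)
          (λ {x} (x∈ , x∉) → x∈ , λ x∈w → x∉ (crossing x x∈ x∈w))
          xs {negate wα} (covers (negate wα))
          (-wα∈ , chamber-acyclic w wα wα∈chamber)
          λ (_ , -wα∉) → -wα∉ -wα∈chamber)
        bound)
        where
        w′ : Word
        w′ = w ++ i ∷ []
        wα : Root
        wα = translate w (simpleRoot i)
        -wα∈ : negate wα ∈ d Z
        -wα∈ with complete (covers wα)
        ... | inj₁ wα∈  = ⊥-elim (wα∉ wα∈)
        ... | inj₂ -wα∈ = -wα∈
        wα∈chamber : wα ∈ chamber w
        wα∈chamber = cone-resp Π (≈ᴹ-sym (act-reverse w (simple i))) (cone-∋ Π (i , ≈ᴹ-refl))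
        -wα∈chamber : negate wα ∈ chamber w′
        -wα∈chamber = ∷ʳ-chamber w i (cone-resp Π (≈ᴹ-sym (begin
          s (simple i) (act (reverse w) (-ᴹ act w (simple i)))
            ≈⟨ s-cong (simple i) (≈ᴹ-trans (act-neg (reverse w) _) (-ᴹ‿cong (act-reverse w _))) ⟩
          s (simple i) (-ᴹ simple i)
            ≈⟨ s-neg (simple i) (simple i) ⟩
          -ᴹ s (simple i) (simple i)
            ≈⟨ -ᴹ‿cong (s-self (simple i) (simple-pos i)) ⟩
          -ᴹ (-ᴹ simple i)
            ≈⟨ -ᴹ-involutive _ ⟩
          simple i ∎)) (cone-∋ Π (i , ≈ᴹ-refl)))
        crossing : ∀ x → x ∈ d Z → x ∈ chamber w → x ∈ chamber w′
        crossing x x∈ x∈w = ∷ʳ-chamber w i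
          (simple-reflection-positive i (translate (reverse w) x) x∈w λ w⁻¹x∼α →
            wα∉ (cx-resp Z {x} {wα} (Setoid.trans Rays {x} {translate w (translate (reverse w) x)} {wα}
              (∼-sym (translate w (translate (reverse w) x)) x (translate-reverse w x))
              (translate-cong w (translate (reverse w) x) (simpleRoot i) w⁻¹x∼α)) x∈))

    acyclic-chamber : ∀ xs → (∀ x → x ∈ᴸ xs) → ∀ X → Acyclic X → ∃[ w ] d X ⊆ chamber w
    acyclic-chamber xs covers X acyclic =
      let Z , X⊆ , acyclicZ , complete = hemispace-extension xs X acyclic
          w , Z⊆ = hemispace-chamber xs covers Z acyclicZ complete
      in w , λ {x} x∈ → Z⊆ {x} (cx-least {X} {Z} X⊆ {x} x∈)

  module _ (finite : Finite) where

    private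
      -- The list given by finiteness may contain vectors that are not roots. One proof of `Φ` per
      -- vector is enough, since `_∼_` ignores these proofs.
      roots : List Carrierᴹ → List Root
      roots []       = []
      roots (v ∷ vs) with em {P = Φ v}
      ... | yes p = (v , p) ∷ roots vs
      ... | no  _ = roots vs

      open SetoidMembership ≈ᴹ-setoid using () renaming (_∈_ to _∈ⱽ_)

      roots-∋ : ∀ vs x → proj₁ x ∈ⱽ vs → x ∈ᴸ roots vs
      roots-∋ (v ∷ vs) (u , p) u∈ with em {P = Φ v}
      roots-∋ (v ∷ vs) (u , p) (here e)   | yes q = here (≈ᴹ⇒∼ p q e)
      roots-∋ (v ∷ vs) (u , p) (there u∈) | yes q = there (roots-∋ vs (u , p) u∈)
      roots-∋ (v ∷ vs) (u , p) (here e)   | no ¬q = ⊥-elim (¬q (Φ-resp e p))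
      roots-∋ (v ∷ vs) (u , p) (there u∈) | no ¬q = roots-∋ vs (u , p) u∈

      rays : List Root
      rays = roots (proj₁ finite)

      covers : ∀ x → x ∈ᴸ rays
      covers (v , p) = roots-∋ (proj₁ finite) (v , p) (proj₂ finite p)

    -- The two structures are arbitrary, so exchanging them yields the reverse inclusion.
    OMRS-⊆ : ∀ d d′ → IsOMRS d → IsOMRS d′ → ∀ X → d X ⊆ d′ X
    OMRS-⊆ d d′ isOMRS isOMRS′ X {x} x∈ with Structure.acyclic-support d isOMRS X x x∈
    ... | Y , Y⊆X , acyclic , x∈dY = M′.monotone {Y} {X} Y⊆X {x} x∈d′Y
      where
      module M = Structure d isOMRS
      module M′ = Structure d′ isOMRS′
      x∈d′Y : x ∈ d′ Y
      x∈d′Y with em {P = x ∈ d′ Y}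
      ... | yes p = p
      ... | no x∉ =
        -- Lying in a chamber, Y is acyclic for d′ too, and remains so after adding - x because x is
        -- not in d′ Y. The chamber w found for d′ is also closed for d, so it contains x along with
        -- - x.
        let u , dY⊆ = M.acyclic-chamber rays covers Y acyclic
            Y⊆ = λ {z} z∈ → dY⊆ {z} (M.extensive Y {z} z∈)
            Y⁻ = Y ∪ ｛ negate x ｝
            w , Y⁻⊆ = M′.acyclic-chamber rays covers Y⁻ (M′.acyclic-∪ Y (negate x)
              (M′.⊆-chamber-acyclic Y u Y⊆)
              λ x∈′ → x∉ (M′.cx-resp Y {negate (negate x)} {x} (negate-involutive x) x∈′))
        in ⊥-elim (chamber-acyclic w x
          (M.chamber-closed w {x} (M.monotone {Y} {chamber w}
            (λ {z} z∈ → Y⁻⊆ {z} (M′.extensive Y⁻ {z} (inj₁ z∈))) {x} x∈dY))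
          (Y⁻⊆ {negate x} (M′.extensive Y⁻ {negate x} (inj₂ (∼-refl (negate x))))))

theorem2 : ExcludedMiddle 0ℓ →
    (ℝ : RealField) (trig : Trigonometry ℝ) (Φ : RootSystem ℝ trig) →
    RootSystem.Finite Φ →
    Σ[ d ∈ (Subset (RootSystem.Rays Φ) → Subset (RootSystem.Rays Φ)) ]
    RootSystem.IsOMRS Φ d ×
    (∀ d′ → RootSystem.IsOMRS Φ d′ →
    ∀ X → SubsetOps._≐_ (RootSystem.Rays Φ) (d′ X) (d X))
theorem2 em ℝ trig R finite = coneΦ , coneΦ-isOMRS , λ d isOMRS X →
    (λ {x} → OMRS-⊆ finite d coneΦ isOMRS coneΦ-isOMRS X {x}) ,
    (λ {x} → OMRS-⊆ finite coneΦ d coneΦ-isOMRS isOMRS X {x})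
  where
  open RootSystem R using (coneΦ)
  open ConeStructure em R using (coneΦ-isOMRS)
  open Chambers em R using (OMRS-⊆)
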